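{- The psi-calculus $\mathbf{PPI}$ is a complete representation of the (unsorted) polyadic pi-calculus.
   Context: **Names, nominal sets.** In what follows there is one countably infinite set $\mathcal N$ of names, all of sort $\mathtt{chan}$. A tilde denotes a finite tuple (or the set of its entries). $\mathrm n(T)$ is the (finite) support of $T$, i.e. its free names; $a\#T$ means $a\notin\mathrm n(T)$. Equivariant means preserved by all name swappings. **The sorted psi-calculus PPI.** Sorts $\mathtt{chan},\mathtt{tup}$. Terms: $\mathbf T=\mathcal N\cup\{\langle\tilde a\rangle:\tilde a\in\mathcal N^*\}$; names have sort $\mathtt{chan}$, tuples have sort $\mathtt{tup}$. Conditions: $\mathbf C=\{\top,\bot\}\cup\{a=b: a,b\in\mathcal N\}$. Assertions: $\mathbf A=\{\mathbf 1\}$, $\mathbf 1\otimes\mathbf 1=\mathbf 1$. Entailment: $\mathbf 1\vdash\top$; $\mathbf 1\vdash a=b$ iff $a$ and $b$ are the same name; $\mathbf 1\not\vdash\bot$. Channel equivalence: $a\leftrightarrow b$ is the condition $a=b$ for names $a,b$, and $M\leftrightarrow N$ is $\bot$ if $M,N$ are not both names. Patterns: $\mathbf X=\{\langle\tilde a\rangle:\tilde a\in\mathcal N^*\text{ with distinct entries}\}$, of sort $\mathtt{tup}$; $\mathrm{vars}(\langle\tilde a\rangle)=\{\tilde a\}$ (all names of the pattern must be bound). $\mathrm{Match}(\langle\tilde a\rangle,\tilde x,\langle\tilde y\rangle)=\{\tilde c\}$ if $\{\tilde x\}=\{\tilde y\}$ and $\langle\tilde y\rangle[\tilde x:=\tilde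 c]=\langle\tilde a\rangle$; $\mathrm{Match}$ is $\emptyset$ otherwise. Only names can be substituted for names; substitution $[\tilde a:=\tilde b]$ on terms and conditions is the usual simultaneous one (patterns are unaffected, all their names being bound). Names of sort $\mathtt{chan}$ may be restricted; a term of sort $\mathtt{chan}$ can send terms of, and receive with patterns of, sort $\mathtt{tup}$ only. **Agents.** $\overline M\,N.P$ (well-formed only if $M$ is a name and $N$ a tuple); $\underline M(\lambda\tilde x)X.P$ (well-formed only if $M$ is a name and $\tilde x$ is a tuple of distinct names listing exactly the names of $X$; $\tilde x$ binds in $X$ and $P$); $\mathbf{case}\ \varphi_1:P_1[]\cdots[]\varphi_n:P_n$ (the empty case is $\mathbf 0$); $(\nu a)P$; $P\mid Q$; $!P$; $(\!|\Psi|\!)$. Agents are identified up to alpha-equivalence. An assertion is unguarded if not inside an input or output; well-formed agents must have no unguarded assertions inside the body of a replication or inside a branch of a case. Only well-formed agents are considered. Substitution on agents is capture-avoiding. **Transitions of PPI** (the only assertion being $\mathbf 1$, it is omitted). Actions: $\overline M(\nu\tilde a)N$ with $\tilde a\subseteq\mathrm n(N)$ (bound names $\tilde a$; written $\overline M\,N$ if $\tilde a$ is empty), $\underline M\,N$, $\tau$. Bound names bind into object and derivative. - In: $\underline M(\lambda\tilde y)X.P\xrightarrow{\underline K\,N}P[\tilde y:=\tilde L]$ if $\mathbf 1\vdash M\leftrightarrow K$ and $\tilde L\in\mathrm{Match}(N,\tilde y,X)$. - Out: $\overline M\,N.P\xrightarrow{\overline K\,N}P$ if $\mathbf 1\vdash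 M\leftrightarrow K$. - Com: if $P\xrightarrow{\overline M(\nu\tilde a)N}P'$, $Q\xrightarrow{\underline K\,N}Q'$, $\mathbf 1\vdash M\leftrightarrow K$, $\tilde a\#Q$, then $P\mid Q\xrightarrow\tau(\nu\tilde a)(P'\mid Q')$ (and symmetrically). - Par: if $P\xrightarrow\alpha P'$ and $\mathrm{bn}(\alpha)\#Q$ then $P\mid Q\xrightarrow\alpha P'\mid Q$ (and symmetrically). - Case: if $P_i\xrightarrow\alpha P'$ and $\mathbf 1\vdash\varphi_i$ then $\mathbf{case}\ \tilde\varphi:\tilde P\xrightarrow\alpha P'$. - Rep: if $P\mid{!P}\xrightarrow\alpha P'$ then $!P\xrightarrow\alpha P'$. - Scope: if $P\xrightarrow\alpha P'$ and $b\#\alpha$ then $(\nu b)P\xrightarrow\alpha(\nu b)P'$. - Open: if $P\xrightarrow{\overline M(\nu\tilde a)N}P'$, $b\#\tilde a,M$, $b\in\mathrm n(N)$, then $(\nu b)P\xrightarrow{\overline M(\nu\tilde a\cup\{b\})N}P'$, where $\tilde a\cup\{b\}$ is $\tilde a$ with $b$ inserted anywhere. **Strong bisimulation congruence.** Since $\mathbf A=\{\mathbf 1\}$, a strong bisimulation is a symmetric relation $\mathcal R$ on agents whose related agents have frames entailing the same conditions (automatic here) and such that if $P\,\mathcal R\,Q$, $\mathrm{bn}(\alpha)\#Q$ and $P\xrightarrow\alpha P'$ then $Q\xrightarrow\alpha Q'$ with $P'\,\mathcal R\,Q'$ for some $Q'$; $\dot\sim$ is the largest one. $P\sim Q$ iff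 $P\tilde\sigma\mathrel{\dot\sim}Q\tilde\sigma$ for all finite sequences $\tilde\sigma$ of substitutions. **Structural congruence of psi-agents.** $\equiv$ is the smallest equivalence relation on agents closed under all agent constructors satisfying, whenever $a\#Q,\tilde x,M,N,X,\tilde\varphi$: $\mathbf{case}\ \varphi_1:(\nu a)P_1[]\cdots[]\varphi_n:(\nu a)P_n\equiv(\nu a)\mathbf{case}\ \tilde\varphi:\tilde P$; $\underline M(\lambda\tilde x)X.(\nu a)P\equiv(\nu a)\underline M(\lambda\tilde x)X.P$; $\overline M\,N.(\nu a)P\equiv(\nu a)\overline M\,N.P$; $Q\mid(\nu a)P\equiv(\nu a)(Q\mid P)$; $(\nu b)(\nu a)P\equiv(\nu a)(\nu b)P$; $!P\equiv P\mid{!P}$; $P\mid(Q\mid R)\equiv(P\mid Q)\mid R$; $P\mid Q\equiv Q\mid P$; $P\equiv P\mid\mathbf 0$; $(\nu a)\mathbf 0\equiv\mathbf 0$. **Representation.** A context $C$ of arity $k$ is a (raw) psi-calculus process term with $k$ occurrences of $\mathbf 0$ replaced by holes, and $C[P_1,\dots,P_k]$ fills the holes from left to right (possibly capturing names). A psi-calculus is a representation of a process calculus with processes $\mathcal P$ and labelled transition system $\to\;\subseteq\mathcal P\times\mathcal A\times\mathcal P$ if there exist an equivariant map $[\![\cdot]\!]$ from $\mathcal P$ to psi-calculus processes and an equivariant relation $\approxeq$ between $\mathcal A$ and psi-calculus actions such that: (1) for each process constructor $f$ of $\mathcal P$ there is an equivariant psi-calculus context $C$ (depending equivariantly on the name parameters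 of $f$, such as $x,\tilde y$ in $x(\tilde y).[\,]$) such that $[\![f(P_1,\dots,P_n)]\!]=C[[\![P_1]\!],\dots,[\![P_n]\!]]$; (2a) whenever $P\xrightarrow\beta P'$ there are $\alpha,Q$ with $[\![P]\!]\xrightarrow\alpha Q$, $[\![P']\!]\equiv Q$ and $\beta\approxeq\alpha$; (2b) whenever $[\![P]\!]\xrightarrow\alpha Q$ there are $\beta,P'$ with $P\xrightarrow\beta P'$, $[\![P']\!]\equiv Q$ and $\beta\approxeq\alpha$. It is complete if moreover (3) for each psi process $P$ there is $Q\in\mathcal P$ with $P\sim[\![Q]\!]$. **Polyadic pi-calculus.** $P,Q::=\mathbf 0\mid x(\tilde y).P\mid\overline x\langle\tilde y\rangle.P\mid[a=b]P\mid\nu x\,P\mid{!P}\mid P\mid Q\mid P+Q$, where in $x(\tilde y).P$ the names $\tilde y$ are distinct and bind in $P$, $\nu x$ binds $x$, processes are up to alpha-equivalence, and $\mathrm{fn}$ denotes free names. Actions: $(\nu\tilde y')\overline z\langle\tilde y\rangle$ with $\tilde y'\subseteq\tilde y$ distinct and $z\notin\tilde y'$ (the order of the bound names $\tilde y'$ is immaterial), $x\langle\tilde z\rangle$, $\tau$. Rules (symmetric ones included): $\overline x\langle\tilde y\rangle.P\xrightarrow{\overline x\langle\tilde y\rangle}P$; $x(\tilde y).P\xrightarrow{x\langle\tilde z\rangle}P\{\tilde z/\tilde y\}$ if $\tilde z,\tilde y$ have the same length; $P\xrightarrow\beta P'$ implies $P+Q\xrightarrow\beta P'$, $[x=x]P\xrightarrow\beta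 P'$, $P\mid Q\xrightarrow\beta P'\mid Q$ if $\mathrm{bn}(\beta)\cap\mathrm{fn}(Q)=\emptyset$, and $\nu x\,P\xrightarrow\beta\nu x\,P'$ if $x\notin\mathrm n(\beta)$; $P\mid{!P}\xrightarrow\beta P'$ implies $!P\xrightarrow\beta P'$; $P\xrightarrow{(\nu\tilde y')\overline x\langle\tilde y\rangle}P'$ and $Q\xrightarrow{x\langle\tilde y\rangle}Q'$ with $\tilde y'\cap\mathrm{fn}(Q)=\emptyset$ imply $P\mid Q\xrightarrow\tau\nu\tilde y'(P'\mid Q')$; $P\xrightarrow{(\nu\tilde y')\overline z\langle\tilde y\rangle}P'$ with $x\ne z$, $x\in\tilde y\setminus\tilde y'$ implies $\nu x\,P\xrightarrow{(\nu x,\tilde y')\overline z\langle\tilde y\rangle}P'$. -}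

module Defs where

open import Level using (0ℓ)
open import Data.Nat.Base using (ℕ; suc; pred; _+_; _⊔_)
open import Data.Nat.Properties using (_≟_; +-cancelˡ-≡)
open import Data.Product.Base using (Σ; ∃-syntax; _×_; _,_)
open import Data.Empty using (⊥-elim)
open import Data.Vec.Base as Vec using (Vec; []; _∷_)
open import Data.List.Base using (List; []; _∷_; [_]; _++_; map; foldr; foldl; filter; length; upTo)
open import Data.List.Properties using (length-map; length-upTo)
open import Data.List.Membership.Propositional using (_∈_; _∉_)
open import Data.List.Membership.Propositional.Properties using (∈-map⁺; ∈-map⁻)
open import Data.List.Membership.DecPropositional _≟_ using (_∉?_)
open import Data.List.Relation.Unary.All as All using (All; []; _∷_)
open import Data.List.Relation.Unary.Any using (here; there)
open import Data.List.Relation.Unary.AllPairs using ([]; _∷_)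
open import Data.List.Relation.Unary.Unique.Propositional using (Unique)
import Data.List.Relation.Unary.Unique.Propositional.Properties as Unique
import Data.List.Relation.Unary.All.Properties as All
open import Data.List.Relation.Binary.Subset.Propositional using (_⊆_)
import Data.List.Relation.Binary.Subset.Propositional.Properties as ⊆
open import Data.List.Relation.Binary.Permutation.Propositional using (_↭_; ↭-refl; ↭-sym; ↭-trans)
import Data.List.Relation.Binary.Permutation.Propositional.Properties as ↭
open import Function.Base using (id; _∘_)
open import Function.Bundles using (_⇔_; mk⇔; Equivalence)
open import Relation.Nullary.Decidable.Core using (yes; no)
open import Relation.Binary.Core using (Rel)
open import Relation.Binary.Definitions using (Symmetric)
open import Relation.Binary.Bundles using (Setoid)
import Relation.Binary.Construct.On as On
open import Relation.Binary.PropositionalEquality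
  using (_≡_; _≢_; refl; cong; cong₂; subst) renaming (sym to ≡-sym; trans to ≡-trans)

Name : Set
Name = ℕ

swapName : Name → Name → Name → Name
swapName a b c with c ≟ a | c ≟ b
... | yes _ | _     = b
... | no _  | yes _ = a
... | no _  | no _  = c

-- For agents, `swap` acts on every occurrence of a name, bound ones included,
-- and `names` lists the free names, i.e. the support of the α-class.
record Nominal (A : Set) : Set where
  field
    swap  : Name → Name → A → A
    names : A → List Name

open Nominal {{...}} public

infix 4 _#_ _#*_ _≐_

_#_ : {A : Set} {{_ : Nominal A}} → Name → A → Set
a # T = a ∉ names T

_#*_ : {A : Set} {{_ : Nominal A}} → List Name → A → Set
as #* T = All (_# T) as

_≐_ : List Name → List Name → Set
xs ≐ ys = ∀ {z} → z ∈ xs ⇔ z ∈ ys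

infixl 6 _∖_

_∖_ : List Name → List Name → List Name
xs ∖ as = filter (_∉? as) xs

-- σ [ as ≔ bs ] maps as to bs pointwise and is σ elsewhere.
_[_≔_] : (Name → Name) → List Name → List Name → Name → Name
(σ [ []     ≔ _      ]) x = σ x
(σ [ _ ∷ _  ≔ []     ]) x = σ x
(σ [ a ∷ as ≔ b ∷ bs ]) x with x ≟ a
... | yes _ = b
... | no _  = (σ [ as ≔ bs ]) x

-- k distinct names that do not occur in the list.
fresh : List Name → ℕ → List Name
fresh xs k = map (suc (foldr _⊔_ 0 xs) +_) (upTo k)

record Substitution : Set where
  field
    from to     : List Name
    distinct    : Unique from
    same-length : length from ≡ length to

  apply : Name → Name
  apply = id [ from ≔ to ]

open Substitution public using (apply)

instance
  nominalName : Nominal Name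
  nominalName = record { swap = swapName ; names = [_] }

  nominalNames : Nominal (List Name)
  nominalNames = record { swap = λ a b → map (swapName a b) ; names = id }

swapName-involutive : ∀ a b c → swapName a b (swapName a b c) ≡ c
swapName-involutive a b c with c ≟ a | c ≟ b
... | no c≢a | no c≢b with c ≟ a | c ≟ b
...   | yes c≡a | _       = ⊥-elim (c≢a c≡a)
...   | no _    | yes c≡b = ⊥-elim (c≢b c≡b)
...   | no _    | no _    = refl
swapName-involutive a b c | no c≢a | yes c≡b with a ≟ a
... | yes _   = ≡-sym c≡b
... | no  a≢a = ⊥-elim (a≢a refl)
swapName-involutive a b c | yes c≡a | _ with b ≟ a | b ≟ b
... | yes b≡a | _       = ≡-trans b≡a (≡-sym c≡a)
... | no _    | yes _   = ≡-sym c≡a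
... | no _    | no b≢b  = ⊥-elim (b≢b refl)

swapName-injective : ∀ a b {c d} → swapName a b c ≡ swapName a b d → c ≡ d
swapName-injective a b {c} {d} eq =
  ≡-trans (≡-sym (swapName-involutive a b c))
    (≡-trans (cong (swapName a b) eq) (swapName-involutive a b d))

swap-Unique : ∀ a b {xs} → Unique xs → Unique (map (swapName a b) xs)
swap-Unique a b = Unique.map⁺ (swapName-injective a b)

swap-∉ : ∀ a b {x xs} → x ∉ xs → swapName a b x ∉ map (swapName a b) xs
swap-∉ a b {xs = xs} x∉xs p with ∈-map⁻ (swapName a b) p
... | y , y∈xs , eq = x∉xs (subst (_∈ xs) (≡-sym (swapName-injective a b eq)) y∈xs)

map-≐ : ∀ (f : Name → Name) {xs ys} → xs ≐ ys → map f xs ≐ map f ys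
map-≐ f {xs} {ys} xs≐ys = mk⇔ (to′ (Equivalence.to xs≐ys)) (to′ (Equivalence.from xs≐ys))
  where
  to′ : ∀ {us vs z} → (∀ {w} → w ∈ us → w ∈ vs) → z ∈ map f us → z ∈ map f vs
  to′ sub p with ∈-map⁻ f p
  ... | w , w∈us , refl = ∈-map⁺ f (sub w∈us)

fresh-Unique : ∀ xs k → Unique (fresh xs k)
fresh-Unique xs k =
  Unique.map⁺ (λ {x} {y} → +-cancelˡ-≡ (suc (foldr _⊔_ 0 xs)) x y) (Unique.upTo⁺ k)

length-fresh : ∀ xs k → length (fresh xs k) ≡ k
length-fresh xs k = ≡-trans (length-map _ (upTo k)) (length-upTo k)

map-≔ : ∀ σ {xs cs} → Unique xs → length xs ≡ length cs →
        map (σ [ xs ≔ cs ]) xs ≡ cs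
map-≔ σ {[]}     {[]}     []          _   = refl
map-≔ σ {x ∷ xs} {c ∷ cs} (x∉xs ∷ u) eq =
  cong₂ _∷_ head (≡-trans (skip xs x∉xs) (map-≔ σ u (cong pred eq)))
  where
  head : (σ [ x ∷ xs ≔ c ∷ cs ]) x ≡ c
  head with x ≟ x
  ... | yes _   = refl
  ... | no  x≢x = ⊥-elim (x≢x refl)

  skip : ∀ zs → All (x ≢_) zs →
         map (σ [ x ∷ xs ≔ c ∷ cs ]) zs ≡ map (σ [ xs ≔ cs ]) zs
  skip []       []           = refl
  skip (z ∷ zs) (x≢z ∷ x∉zs) = cong₂ _∷_ hd (skip zs x∉zs)
    where
    hd : (σ [ x ∷ xs ≔ c ∷ cs ]) z ≡ (σ [ xs ≔ cs ]) z
    hd with z ≟ x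
    ... | yes z≡x = ⊥-elim (x≢z (≡-sym z≡x))
    ... | no  _   = refl

Unique-map-injective : ∀ (f : Name → Name) {xs} → Unique (map f xs) →
                       ∀ {x y} → x ∈ xs → y ∈ xs → f x ≡ f y → x ≡ y
Unique-map-injective f (_  ∷ _) (here refl) (here refl) _  = refl
Unique-map-injective f (ne ∷ _) (here refl) (there q)   eq =
  ⊥-elim (All.lookup ne (∈-map⁺ f q) eq)
Unique-map-injective f (ne ∷ _) (there p)   (here refl) eq =
  ⊥-elim (All.lookup ne (∈-map⁺ f p) (≡-sym eq))
Unique-map-injective f (_  ∷ u) (there p)   (there q)   eq =
  Unique-map-injective f u p q eq

Unique-map-⊆ : ∀ (f : Name → Name) {xs} → Unique (map f xs) →
               ∀ {ys} → Unique ys → ys ⊆ xs → Unique (map f ys)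
Unique-map-⊆ f u {[]}     []          _   = []
Unique-map-⊆ f u {y ∷ ys} (y∉ys ∷ v) sub =
  All.map⁺ (All.tabulate λ z∈ys eq → All.lookup y∉ys z∈ys
    (Unique-map-injective f u (sub (here refl)) (sub (there z∈ys)) eq))
  ∷ Unique-map-⊆ f u v (sub ∘ there)

module PPI where

  data Term : Set where
    name  : Name → Term
    tuple : List Name → Term

  data Condition : Set where
    ⊤ᶜ ⊥ᶜ : Condition
    _≈_   : Name → Name → Condition

  data Assertion : Set where
    𝟏 : Assertion

  -- The requirement that the entries be distinct is part of WellFormed.
  data Pattern : Set where
    ⟨_⟩ : List Name → Pattern

  mapTerm : (Name → Name) → Term → Term
  mapTerm f (name a)   = name (f a)
  mapTerm f (tuple as) = tuple (map f as)

  mapCondition : (Name → Name) → Condition → Condition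
  mapCondition f ⊤ᶜ      = ⊤ᶜ
  mapCondition f ⊥ᶜ      = ⊥ᶜ
  mapCondition f (a ≈ b) = f a ≈ f b

  mapPattern : (Name → Name) → Pattern → Pattern
  mapPattern f ⟨ as ⟩ = ⟨ map f as ⟩

  namesTerm : Term → List Name
  namesTerm (name a)   = [ a ]
  namesTerm (tuple as) = as

  namesCondition : Condition → List Name
  namesCondition ⊤ᶜ      = []
  namesCondition ⊥ᶜ      = []
  namesCondition (a ≈ b) = a ∷ b ∷ []

  namesPattern : Pattern → List Name
  namesPattern ⟨ as ⟩ = as

  instance
    nominalTerm : Nominal Term
    nominalTerm = record { swap = λ a b → mapTerm (swapName a b) ; names = namesTerm }

    nominalCondition : Nominal Condition
    nominalCondition =
      record { swap = λ a b → mapCondition (swapName a b) ; names = namesCondition }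

    nominalPattern : Nominal Pattern
    nominalPattern =
      record { swap = λ a b → mapPattern (swapName a b) ; names = namesPattern }

  infix 4 _⊢_

  data _⊢_ : Assertion → Condition → Set where
    ⊢⊤ : 𝟏 ⊢ ⊤ᶜ
    ⊢≈ : ∀ {a} → 𝟏 ⊢ a ≈ a

  _↔_ : Term → Term → Condition
  name a ↔ name b = a ≈ b
  _      ↔ _      = ⊥ᶜ

  -- Match N xs X cs means cs ∈ MATCH(N, xs, X).
  data Match : Term → List Name → Pattern → List Name → Set where
    match : ∀ {as xs ys cs} → xs ≐ ys → length xs ≡ length cs →
            map (id [ xs ≔ cs ]) ys ≡ as →
            Match (tuple as) xs ⟨ ys ⟩ cs

  infixr 6 _∣_
  infixr 5 _∶_□_

  data Agent : Set
  data Branches : Set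

  data Agent where
    output    : Term → Term → Agent → Agent
    input     : Term → List Name → Pattern → Agent → Agent
    case      : Branches → Agent
    ν         : Name → Agent → Agent
    _∣_       : Agent → Agent → Agent
    !_        : Agent → Agent
    assertion : Assertion → Agent

  data Branches where
    []    : Branches
    _∶_□_ : Condition → Agent → Branches → Branches

  𝟎 : Agent
  𝟎 = case []

  ν* : List Name → Agent → Agent
  ν* as P = foldr ν P as

  swapAgent    : Name → Name → Agent → Agent
  swapBranches : Name → Name → Branches → Branches

  swapAgent a b (output M N P)   = output (swap a b M) (swap a b N) (swapAgent a b P)
  swapAgent a b (input M xs X P) =
    input (swap a b M) (swap a b xs) (swap a b X) (swapAgent a b P)
  swapAgent a b (case bs)        = case (swapBranches a b bs)
  swapAgent a b (ν c P)          = ν (swap a b c) (swapAgent a b P)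
  swapAgent a b (P ∣ Q)          = swapAgent a b P ∣ swapAgent a b Q
  swapAgent a b (! P)            = ! swapAgent a b P
  swapAgent a b (assertion Ψ)    = assertion Ψ

  swapBranches a b []           = []
  swapBranches a b (φ ∶ P □ bs) = swap a b φ ∶ swapAgent a b P □ swapBranches a b bs

  namesAgent    : Agent → List Name
  namesBranches : Branches → List Name

  namesAgent (output M N P)   = names M ++ names N ++ namesAgent P
  namesAgent (input M xs X P) = names M ++ ((names X ++ namesAgent P) ∖ xs)
  namesAgent (case bs)        = namesBranches bs
  namesAgent (ν a P)          = namesAgent P ∖ [ a ]
  namesAgent (P ∣ Q)          = namesAgent P ++ namesAgent Q
  namesAgent (! P)            = namesAgent P
  namesAgent (assertion Ψ)    = []

  namesBranches []           = []
  namesBranches (φ ∶ P □ bs) = names φ ++ namesAgent P ++ namesBranches bs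

  instance
    nominalAgent : Nominal Agent
    nominalAgent = record { swap = swapAgent ; names = namesAgent }

    nominalBranches : Nominal Branches
    nominalBranches = record { swap = swapBranches ; names = namesBranches }

  -- Capture-avoiding: every binder is renamed to names outside the image under σ
  -- of the names of its scope.
  substitute  : (Name → Name) → Agent → Agent
  substituteᵇ : (Name → Name) → Branches → Branches

  substitute σ (output M N P)   = output (mapTerm σ M) (mapTerm σ N) (substitute σ P)
  substitute σ (input M xs X P) =
    let xs′ = fresh (map σ (names X ++ names P)) (length xs) in
    input (mapTerm σ M) xs′ (mapPattern (σ [ xs ≔ xs′ ]) X)
          (substitute (σ [ xs ≔ xs′ ]) P)
  substitute σ (case bs)        = case (substituteᵇ σ bs)
  substitute σ (ν a P)          =
    let a′ = suc (foldr _⊔_ 0 (map σ (names P))) in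
    ν a′ (substitute (σ [ [ a ] ≔ [ a′ ] ]) P)
  substitute σ (P ∣ Q)          = substitute σ P ∣ substitute σ Q
  substitute σ (! P)            = ! substitute σ P
  substitute σ (assertion Ψ)    = assertion Ψ

  substituteᵇ σ []           = []
  substituteᵇ σ (φ ∶ P □ bs) = mapCondition σ φ ∶ substitute σ P □ substituteᵇ σ bs

  -- Guarded P: no assertion of P lies outside every input and output.
  data Guarded  : Agent → Set
  data Guardedᵇ : Branches → Set

  data Guarded where
    output : ∀ {M N P} → Guarded (output M N P)
    input  : ∀ {M xs X P} → Guarded (input M xs X P)
    case   : ∀ {bs} → Guardedᵇ bs → Guarded (case bs)
    ν      : ∀ {a P} → Guarded P → Guarded (ν a P)
    _∣_    : ∀ {P Q} → Guarded P → Guarded Q → Guarded (P ∣ Q)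
    !_     : ∀ {P} → Guarded P → Guarded (! P)

  data Guardedᵇ where
    []  : Guardedᵇ []
    _∷_ : ∀ {φ P bs} → Guarded P → Guardedᵇ bs → Guardedᵇ (φ ∶ P □ bs)

  data WellFormed  : Agent → Set
  data WellFormedᵇ : Branches → Set

  data WellFormed where
    output    : ∀ {a bs P} → WellFormed P → WellFormed (output (name a) (tuple bs) P)
    input     : ∀ {a xs ys P} → Unique ys → Unique xs → xs ≐ ys → WellFormed P →
                WellFormed (input (name a) xs ⟨ ys ⟩ P)
    case      : ∀ {bs} → Guardedᵇ bs → WellFormedᵇ bs → WellFormed (case bs)
    ν         : ∀ {a P} → WellFormed P → WellFormed (ν a P)
    _∣_       : ∀ {P Q} → WellFormed P → WellFormed Q → WellFormed (P ∣ Q)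
    rep       : ∀ {P} → Guarded P → WellFormed P → WellFormed (! P)
    assertion : ∀ {Ψ} → WellFormed (assertion Ψ)

  data WellFormedᵇ where
    []  : WellFormedᵇ []
    _∷_ : ∀ {φ P bs} → WellFormed P → WellFormedᵇ bs → WellFormedᵇ (φ ∶ P □ bs)

  record Process : Set where
    constructor _,_
    field
      agent      : Agent
      wellFormed : WellFormed agent

  open Process public

  substitute-Guarded  : ∀ σ {P} → Guarded P → Guarded (substitute σ P)
  substitute-Guardedᵇ : ∀ σ {bs} → Guardedᵇ bs → Guardedᵇ (substituteᵇ σ bs)

  substitute-Guarded σ output    = output
  substitute-Guarded σ input     = input
  substitute-Guarded σ (case gs) = case (substitute-Guardedᵇ σ gs)
  substitute-Guarded σ (ν g)     = ν (substitute-Guarded _ g)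
  substitute-Guarded σ (g ∣ h)   = substitute-Guarded σ g ∣ substitute-Guarded σ h
  substitute-Guarded σ (! g)     = ! substitute-Guarded σ g

  substitute-Guardedᵇ σ []       = []
  substitute-Guardedᵇ σ (g ∷ gs) = substitute-Guarded σ g ∷ substitute-Guardedᵇ σ gs

  substitute-WellFormed  : ∀ σ {P} → WellFormed P → WellFormed (substitute σ P)
  substitute-WellFormedᵇ : ∀ σ {bs} → WellFormedᵇ bs → WellFormedᵇ (substituteᵇ σ bs)

  substitute-WellFormed σ (output w) = output (substitute-WellFormed σ w)
  substitute-WellFormed σ {input _ xs ⟨ ys ⟩ P} (input u v xs≐ys w) =
    input (Unique-map-⊆ σ′ (subst Unique (≡-sym eq) v′) u (Equivalence.from xs≐ys)) v′
          (subst (_≐ map σ′ ys) eq (map-≐ σ′ xs≐ys))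
          (substitute-WellFormed σ′ w)
    where
    avoid xs′ : List Name
    avoid = map σ (ys ++ names P)
    xs′   = fresh avoid (length xs)

    σ′ : Name → Name
    σ′ = σ [ xs ≔ xs′ ]

    v′ : Unique xs′
    v′ = fresh-Unique avoid (length xs)

    eq : map σ′ xs ≡ xs′
    eq = map-≔ σ v (≡-sym (length-fresh avoid (length xs)))
  substitute-WellFormed σ (case gs ws)  =
    case (substitute-Guardedᵇ σ gs) (substitute-WellFormedᵇ σ ws)
  substitute-WellFormed σ (ν w)         = ν (substitute-WellFormed _ w)
  substitute-WellFormed σ (w ∣ v)       = substitute-WellFormed σ w ∣ substitute-WellFormed σ v
  substitute-WellFormed σ (rep g w)     = rep (substitute-Guarded σ g) (substitute-WellFormed σ w)
  substitute-WellFormed σ assertion     = assertion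

  substitute-WellFormedᵇ σ []       = []
  substitute-WellFormedᵇ σ (w ∷ ws) = substitute-WellFormed σ w ∷ substitute-WellFormedᵇ σ ws

  infixl 6 _⟪_⟫ _⟪_⟫*

  _⟪_⟫ : Process → Substitution → Process
  (P , w) ⟪ σ ⟫ = substitute (apply σ) P , substitute-WellFormed (apply σ) w

  _⟪_⟫* : Process → List Substitution → Process
  P ⟪ σs ⟫* = foldl _⟪_⟫ P σs

  infix 4 _=α_ _=αᵇ_

  data _=α_  : Agent → Agent → Set
  data _=αᵇ_ : Branches → Branches → Set

  data _=α_ where
    refl  : ∀ {P} → P =α P
    sym   : ∀ {P Q} → P =α Q → Q =α P
    trans : ∀ {P Q R} → P =α Q → Q =α R → P =α R

    rename-ν     : ∀ {a b P} → b # P → ν a P =α ν b (swap a b P)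
    rename-input : ∀ {a b M xs X P} → a ∈ xs → b # xs → b # X → b # P →
                   input M xs X P =α input M (swap a b xs) (swap a b X) (swap a b P)

    output : ∀ {M N P Q} → P =α Q → output M N P =α output M N Q
    input  : ∀ {M xs X P Q} → P =α Q → input M xs X P =α input M xs X Q
    case   : ∀ {bs cs} → bs =αᵇ cs → case bs =α case cs
    ν      : ∀ {a P Q} → P =α Q → ν a P =α ν a Q
    _∣_    : ∀ {P Q P′ Q′} → P =α P′ → Q =α Q′ → P ∣ Q =α P′ ∣ Q′
    !_     : ∀ {P Q} → P =α Q → ! P =α ! Q

  data _=αᵇ_ where
    []  : [] =αᵇ []
    _∷_ : ∀ {φ P Q bs cs} → P =α Q → bs =αᵇ cs → φ ∶ P □ bs =αᵇ φ ∶ Q □ cs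

  data RawAction : Set where
    output : Term → List Name → Term → RawAction
    input  : Term → Term → RawAction
    τ      : RawAction

  bn : RawAction → List Name
  bn (output M as N) = as
  bn (input M N)     = []
  bn τ               = []

  -- The bound names of an action belong to its support.
  instance
    nominalAction : Nominal RawAction
    nominalAction = record { swap = swapAction ; names = namesAction }
      where
      swapAction : Name → Name → RawAction → RawAction
      swapAction a b (output M as N) = output (swap a b M) (swap a b as) (swap a b N)
      swapAction a b (input M N)     = input (swap a b M) (swap a b N)
      swapAction a b τ               = τ

      namesAction : RawAction → List Name
      namesAction (output M as N) = names M ++ as ++ names N
      namesAction (input M N)     = names M ++ names N
      namesAction τ               = []

  data WellFormedAction : RawAction → Set where
    output : ∀ {M as N} → Unique as → as ⊆ names N → WellFormedAction (output M as N)
    input  : ∀ {M N} → WellFormedAction (input M N)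
    τ      : WellFormedAction τ

  record Action : Set where
    constructor _,_
    field
      label      : RawAction
      wellFormed : WellFormedAction label

  open Action public using (label)

  swap-WellFormedAction : ∀ a b {α} → WellFormedAction α → WellFormedAction (swap a b α)
  swap-WellFormedAction a b (output {N = name _}  u s) =
    output (swap-Unique a b u) (⊆.map⁺ (swapName a b) s)
  swap-WellFormedAction a b (output {N = tuple _} u s) =
    output (swap-Unique a b u) (⊆.map⁺ (swapName a b) s)
  swap-WellFormedAction a b input = input
  swap-WellFormedAction a b τ     = τ

  swapAction : Name → Name → Action → Action
  swapAction a b (α , w) = swap a b α , swap-WellFormedAction a b w

  infix 4 _∶_∈ᵇ_

  data _∶_∈ᵇ_ (φ : Condition) (P : Agent) : Branches → Set where
    here  : ∀ {bs} → φ ∶ P ∈ᵇ φ ∶ P □ bs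
    there : ∀ {ψ Q bs} → φ ∶ P ∈ᵇ bs → φ ∶ P ∈ᵇ ψ ∶ Q □ bs

  infix 4 _—[_]→_

  -- agents-α says that agents are taken up to α-equivalence. bound-α says that the
  -- bound names of an output bind into its object and derivative; since they do not
  -- bind into the subject, renaming keeps them distinct from the subject, as Open
  -- does.
  data _—[_]→_ : Agent → RawAction → Agent → Set where
    agents-α : ∀ {P P₁ α P₁′ P′} → P =α P₁ → P₁ —[ α ]→ P₁′ → P₁′ =α P′ → P —[ α ]→ P′

    bound-α : ∀ {P M as N P′ a b} → P —[ output M as N ]→ P′ →
              a ∈ as → b # M → b # N → b # P′ →
              P —[ output M (swap a b as) (swap a b N) ]→ swap a b P′

    In : ∀ {M K N ys X P Ls} → 𝟏 ⊢ M ↔ K → Match N ys X Ls →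
         input M ys X P —[ input K N ]→ substitute (id [ ys ≔ Ls ]) P

    Out : ∀ {M K N P} → 𝟏 ⊢ M ↔ K → output M N P —[ output K [] N ]→ P

    Comˡ : ∀ {P Q P′ Q′ M K N as} →
           P —[ output M as N ]→ P′ → Q —[ input K N ]→ Q′ → 𝟏 ⊢ M ↔ K → as #* Q →
           P ∣ Q —[ τ ]→ ν* as (P′ ∣ Q′)

    Comʳ : ∀ {P Q P′ Q′ M K N as} →
           P —[ input K N ]→ P′ → Q —[ output M as N ]→ Q′ → 𝟏 ⊢ M ↔ K → as #* P →
           P ∣ Q —[ τ ]→ ν* as (P′ ∣ Q′)

    Parˡ : ∀ {P Q P′ α} → P —[ α ]→ P′ → bn α #* Q → P ∣ Q —[ α ]→ P′ ∣ Q
    Parʳ : ∀ {P Q Q′ α} → Q —[ α ]→ Q′ → bn α #* P → P ∣ Q —[ α ]→ P ∣ Q′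

    Case : ∀ {φ P bs α P′} → φ ∶ P ∈ᵇ bs → P —[ α ]→ P′ → 𝟏 ⊢ φ → case bs —[ α ]→ P′

    Rep : ∀ {P α P′} → P ∣ ! P —[ α ]→ P′ → ! P —[ α ]→ P′

    Scope : ∀ {P α P′ b} → P —[ α ]→ P′ → b # α → ν b P —[ α ]→ ν b P′

    Open : ∀ {P M as as′ N P′ b} → P —[ output M (as ++ as′) N ]→ P′ →
           b # (as ++ as′) → b # M → b ∈ names N →
           ν b P —[ output M (as ++ b ∷ as′) N ]→ P′

  -- There is a single assertion, so all frames entail the same conditions and
  -- assertion extension is vacuous.
  record IsBisimulation (R : Rel Process 0ℓ) : Set where
    field
      symmetric : Symmetric R
      simulates : ∀ {P Q P′ : Process} {α : Action} → R P Q → bn (label α) #* agent Q →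
                  agent P —[ label α ]→ agent P′ →
                  ∃[ Q′ ] agent Q —[ label α ]→ agent Q′ × R P′ Q′

  infix 4 _∼̇_ _∼_

  _∼̇_ : Process → Process → Set₁
  P ∼̇ Q = ∃[ R ] IsBisimulation R × R P Q

  _∼_ : Process → Process → Set₁
  P ∼ Q = ∀ (σs : List Substitution) → P ⟪ σs ⟫* ∼̇ Q ⟪ σs ⟫*

  infix 4 _≋_ _≋ᵇ_

  conditionNames : Branches → List Name
  conditionNames []           = []
  conditionNames (φ ∶ P □ bs) = names φ ++ conditionNames bs

  νᵇ : Name → Branches → Branches
  νᵇ a []           = []
  νᵇ a (φ ∶ P □ bs) = φ ∶ ν a P □ νᵇ a bs

  data _≋_  : Agent → Agent → Set
  data _≋ᵇ_ : Branches → Branches → Set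

  data _≋_ where
    α-equiv : ∀ {P Q} → P =α Q → P ≋ Q

    refl  : ∀ {P} → P ≋ P
    sym   : ∀ {P Q} → P ≋ Q → Q ≋ P
    trans : ∀ {P Q R} → P ≋ Q → Q ≋ R → P ≋ R

    output : ∀ {M N P Q} → P ≋ Q → output M N P ≋ output M N Q
    input  : ∀ {M xs X P Q} → P ≋ Q → input M xs X P ≋ input M xs X Q
    case   : ∀ {bs cs} → bs ≋ᵇ cs → case bs ≋ case cs
    ν      : ∀ {a P Q} → P ≋ Q → ν a P ≋ ν a Q
    _∣_    : ∀ {P Q P′ Q′} → P ≋ P′ → Q ≋ Q′ → P ∣ Q ≋ P′ ∣ Q′
    !_     : ∀ {P Q} → P ≋ Q → ! P ≋ ! Q

    scope-case   : ∀ {a bs} → a # conditionNames bs → case (νᵇ a bs) ≋ ν a (case bs)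
    scope-input  : ∀ {a M xs X P} → a # M → a # xs → a # X →
                   input M xs X (ν a P) ≋ ν a (input M xs X P)
    scope-output : ∀ {a M N P} → a # M → a # N → output M N (ν a P) ≋ ν a (output M N P)
    scope-par    : ∀ {a P Q} → a # Q → Q ∣ ν a P ≋ ν a (Q ∣ P)
    scope-comm   : ∀ {a b P} → ν b (ν a P) ≋ ν a (ν b P)
    unfold       : ∀ {P} → ! P ≋ P ∣ ! P
    par-assoc    : ∀ {P Q R} → P ∣ (Q ∣ R) ≋ (P ∣ Q) ∣ R
    par-comm     : ∀ {P Q} → P ∣ Q ≋ Q ∣ P
    par-unit     : ∀ {P} → P ≋ P ∣ 𝟎
    ν-unit       : ∀ {a} → ν a 𝟎 ≋ 𝟎

  data _≋ᵇ_ where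
    []  : [] ≋ᵇ []
    _∷_ : ∀ {φ P Q bs cs} → P ≋ Q → bs ≋ᵇ cs → φ ∶ P □ bs ≋ᵇ φ ∶ Q □ cs

  -- Indexed by the number of holes, which are filled from left to right.
  data Context         : ℕ → Set
  data BranchesContext : ℕ → Set

  data Context where
    hole      : Context 1
    output    : ∀ {k} → Term → Term → Context k → Context k
    input     : ∀ {k} → Term → List Name → Pattern → Context k → Context k
    case      : ∀ {k} → BranchesContext k → Context k
    ν         : ∀ {k} → Name → Context k → Context k
    _∣_       : ∀ {k l} → Context k → Context l → Context (k + l)
    !_        : ∀ {k} → Context k → Context k
    assertion : Assertion → Context 0

  data BranchesContext where
    []    : BranchesContext 0
    _∶_□_ : ∀ {k l} → Condition → Context k → BranchesContext l → BranchesContext (k + l)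

  swapContext         : ∀ {k} → Name → Name → Context k → Context k
  swapBranchesContext : ∀ {k} → Name → Name → BranchesContext k → BranchesContext k

  swapContext a b hole             = hole
  swapContext a b (output M N C)   = output (swap a b M) (swap a b N) (swapContext a b C)
  swapContext a b (input M xs X C) =
    input (swap a b M) (swap a b xs) (swap a b X) (swapContext a b C)
  swapContext a b (case Bs)        = case (swapBranchesContext a b Bs)
  swapContext a b (ν c C)          = ν (swap a b c) (swapContext a b C)
  swapContext a b (C ∣ D)          = swapContext a b C ∣ swapContext a b D
  swapContext a b (! C)            = ! swapContext a b C
  swapContext a b (assertion Ψ)    = assertion Ψ

  swapBranchesContext a b []           = []
  swapBranchesContext a b (φ ∶ C □ Bs) =
    swap a b φ ∶ swapContext a b C □ swapBranchesContext a b Bs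

  fill         : ∀ {k} → Context k → Vec Agent k → Agent
  fillBranches : ∀ {k} → BranchesContext k → Vec Agent k → Branches

  fill hole             (P ∷ []) = P
  fill (output M N C)   Ps = output M N (fill C Ps)
  fill (input M xs X C) Ps = input M xs X (fill C Ps)
  fill (case Bs)        Ps = case (fillBranches Bs Ps)
  fill (ν c C)          Ps = ν c (fill C Ps)
  fill (_∣_ {k} C D)    Ps = fill C (Vec.take k Ps) ∣ fill D (Vec.drop k Ps)
  fill (! C)            Ps = ! fill C Ps
  fill (assertion Ψ)    Ps = assertion Ψ

  fillBranches []                   Ps = []
  fillBranches (_∶_□_ {k} φ C Bs)   Ps =
    φ ∶ fill C (Vec.take k Ps) □ fillBranches Bs (Vec.drop k Ps)

-- The setoid equalities say when two processes (resp. actions) are identified.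
-- A constructor comprises its name parameters: x(ỹ).[ ] is one element of
-- Constructor 1 for each choice of x and ỹ.
record ProcessCalculus : Set₁ where
  field
    processes : Setoid 0ℓ 0ℓ
    actions   : Setoid 0ℓ 0ℓ

  Process : Set
  Process = Setoid.Carrier processes

  Action : Set
  Action = Setoid.Carrier actions

  field
    swapProcess     : Name → Name → Process → Process
    swapAction      : Name → Name → Action → Action
    Constructor     : ℕ → Set
    swapConstructor : ∀ {k} → Name → Name → Constructor k → Constructor k
    construct       : ∀ {k} → Constructor k → Vec Process k → Process
    Transition      : Process → Action → Process → Set

record Representation (𝒫 : ProcessCalculus) : Set₁ where
  open ProcessCalculus 𝒫
  open Setoid processes using () renaming (_≈_ to _≈ₚ_)
  open Setoid actions   using () renaming (_≈_ to _≈ₐ_)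
  open PPI using (agent; label; _=α_; _—[_]→_; _≋_; Context; swapContext; fill)

  field
    ⟦_⟧             : Process → PPI.Process
    ⟦⟧-cong         : ∀ {P Q} → P ≈ₚ Q → agent ⟦ P ⟧ =α agent ⟦ Q ⟧
    ⟦⟧-equivariant  : ∀ a b P → agent ⟦ swapProcess a b P ⟧ =α swap a b (agent ⟦ P ⟧)

    _≊_             : Action → PPI.Action → Set
    ≊-resp          : ∀ {β β′ α} → β ≈ₐ β′ → β ≊ α → β′ ≊ α
    ≊-equivariant   : ∀ a b {β α} → β ≊ α → swapAction a b β ≊ PPI.swapAction a b α

    context             : ∀ {k} → Constructor k → Context k
    context-equivariant : ∀ {k} a b (f : Constructor k) →
                          context (swapConstructor a b f) ≡ swapContext a b (context f)
    compositional       : ∀ {k} (f : Constructor k) (Ps : Vec Process k) →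
                          agent ⟦ construct f Ps ⟧ =α
                          fill (context f) (Vec.map (agent ∘ ⟦_⟧) Ps)

    preserves : ∀ {P β P′} → Transition P β P′ →
               Σ PPI.Action λ α → Σ PPI.Process λ Q →
                 agent ⟦ P ⟧ —[ label α ]→ agent Q × agent ⟦ P′ ⟧ ≋ agent Q × β ≊ α
    reflects  : ∀ {P} {α : PPI.Action} {Q : PPI.Process} →
               agent ⟦ P ⟧ —[ label α ]→ agent Q →
               Σ Action λ β → Σ Process λ P′ →
                 Transition P β P′ × agent ⟦ P′ ⟧ ≋ agent Q × β ≊ α

record CompleteRepresentation (𝒫 : ProcessCalculus) : Set₁ where
  open ProcessCalculus 𝒫

  field
    representation : Representation 𝒫

  open Representation representation public

  field
    complete : ∀ (P : PPI.Process) → Σ Process λ Q → P PPI.∼ ⟦ Q ⟧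

module PolyadicPi where

  infixr 6 _∣_
  infixr 5 _⊕_

  data Agent : Set where
    𝟎      : Agent
    input  : Name → List Name → Agent → Agent
    output : Name → List Name → Agent → Agent
    match  : Name → Name → Agent → Agent
    ν      : Name → Agent → Agent
    !_     : Agent → Agent
    _∣_    : Agent → Agent → Agent
    _⊕_    : Agent → Agent → Agent

  ν* : List Name → Agent → Agent
  ν* xs P = foldr ν P xs

  swapAgent : Name → Name → Agent → Agent
  swapAgent a b 𝟎               = 𝟎
  swapAgent a b (input x ys P)  = input (swap a b x) (swap a b ys) (swapAgent a b P)
  swapAgent a b (output x ys P) = output (swap a b x) (swap a b ys) (swapAgent a b P)
  swapAgent a b (match c d P)   = match (swap a b c) (swap a b d) (swapAgent a b P)
  swapAgent a b (ν x P)         = ν (swap a b x) (swapAgent a b P)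
  swapAgent a b (! P)           = ! swapAgent a b P
  swapAgent a b (P ∣ Q)         = swapAgent a b P ∣ swapAgent a b Q
  swapAgent a b (P ⊕ Q)         = swapAgent a b P ⊕ swapAgent a b Q

  fn : Agent → List Name
  fn 𝟎               = []
  fn (input x ys P)  = x ∷ (fn P ∖ ys)
  fn (output x ys P) = x ∷ ys ++ fn P
  fn (match a b P)   = a ∷ b ∷ fn P
  fn (ν x P)         = fn P ∖ [ x ]
  fn (! P)           = fn P
  fn (P ∣ Q)         = fn P ++ fn Q
  fn (P ⊕ Q)         = fn P ++ fn Q

  instance
    nominalPi : Nominal Agent
    nominalPi = record { swap = swapAgent ; names = fn }

  substitute : (Name → Name) → Agent → Agent
  substitute σ 𝟎               = 𝟎
  substitute σ (input x ys P)  =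
    let ys′ = fresh (map σ (fn P)) (length ys) in
    input (σ x) ys′ (substitute (σ [ ys ≔ ys′ ]) P)
  substitute σ (output x ys P) = output (σ x) (map σ ys) (substitute σ P)
  substitute σ (match a b P)   = match (σ a) (σ b) (substitute σ P)
  substitute σ (ν x P)         =
    let x′ = suc (foldr _⊔_ 0 (map σ (fn P))) in
    ν x′ (substitute (σ [ [ x ] ≔ [ x′ ] ]) P)
  substitute σ (! P)           = ! substitute σ P
  substitute σ (P ∣ Q)         = substitute σ P ∣ substitute σ Q
  substitute σ (P ⊕ Q)         = substitute σ P ⊕ substitute σ Q

  data WellFormed : Agent → Set where
    𝟎      : WellFormed 𝟎
    input  : ∀ {x ys P} → Unique ys → WellFormed P → WellFormed (input x ys P)
    output : ∀ {x ys P} → WellFormed P → WellFormed (output x ys P)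
    match  : ∀ {a b P} → WellFormed P → WellFormed (match a b P)
    ν      : ∀ {x P} → WellFormed P → WellFormed (ν x P)
    !_     : ∀ {P} → WellFormed P → WellFormed (! P)
    _∣_    : ∀ {P Q} → WellFormed P → WellFormed Q → WellFormed (P ∣ Q)
    _⊕_    : ∀ {P Q} → WellFormed P → WellFormed Q → WellFormed (P ⊕ Q)

  record Process : Set where
    constructor _,_
    field
      agent      : Agent
      wellFormed : WellFormed agent

  open Process public

  swap-WellFormed : ∀ a b {P} → WellFormed P → WellFormed (swap a b P)
  swap-WellFormed a b 𝟎           = 𝟎
  swap-WellFormed a b (input u w) = input (swap-Unique a b u) (swap-WellFormed a b w)
  swap-WellFormed a b (output w)  = output (swap-WellFormed a b w)
  swap-WellFormed a b (match w)   = match (swap-WellFormed a b w)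
  swap-WellFormed a b (ν w)       = ν (swap-WellFormed a b w)
  swap-WellFormed a b (! w)       = ! swap-WellFormed a b w
  swap-WellFormed a b (w ∣ v)     = swap-WellFormed a b w ∣ swap-WellFormed a b v
  swap-WellFormed a b (w ⊕ v)     = swap-WellFormed a b w ⊕ swap-WellFormed a b v

  infix 4 _=α_

  data _=α_ : Agent → Agent → Set where
    refl  : ∀ {P} → P =α P
    sym   : ∀ {P Q} → P =α Q → Q =α P
    trans : ∀ {P Q R} → P =α Q → Q =α R → P =α R

    rename-ν     : ∀ {a b P} → b # P → ν a P =α ν b (swap a b P)
    rename-input : ∀ {a b x ys P} → a ∈ ys → b # ys → b # P →
                   input x ys P =α input x (swap a b ys) (swap a b P)

    input  : ∀ {x ys P Q} → P =α Q → input x ys P =α input x ys Q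
    output : ∀ {x ys P Q} → P =α Q → output x ys P =α output x ys Q
    match  : ∀ {a b P Q} → P =α Q → match a b P =α match a b Q
    ν      : ∀ {x P Q} → P =α Q → ν x P =α ν x Q
    !_     : ∀ {P Q} → P =α Q → ! P =α ! Q
    _∣_    : ∀ {P Q P′ Q′} → P =α P′ → Q =α Q′ → P ∣ Q =α P′ ∣ Q′
    _⊕_    : ∀ {P Q P′ Q′} → P =α P′ → Q =α Q′ → P ⊕ Q =α P′ ⊕ Q′

  -- output ys′ z ys is (νys′) z̄⟨ys⟩.
  data RawAction : Set where
    output : List Name → Name → List Name → RawAction
    input  : Name → List Name → RawAction
    τ      : RawAction

  bn : RawAction → List Name
  bn (output ys′ z ys) = ys′
  bn (input x zs)      = []
  bn τ                 = []

  instance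
    nominalAction : Nominal RawAction
    nominalAction = record { swap = swapRaw ; names = namesAction }
      where
      swapRaw : Name → Name → RawAction → RawAction
      swapRaw a b (output ys′ z ys) = output (swap a b ys′) (swap a b z) (swap a b ys)
      swapRaw a b (input x zs)      = input (swap a b x) (swap a b zs)
      swapRaw a b τ                 = τ

      namesAction : RawAction → List Name
      namesAction (output ys′ z ys) = ys′ ++ z ∷ ys
      namesAction (input x zs)      = x ∷ zs
      namesAction τ                 = []

  data WellFormedAction : RawAction → Set where
    output : ∀ {ys′ z ys} → Unique ys′ → ys′ ⊆ ys → z ∉ ys′ →
             WellFormedAction (output ys′ z ys)
    input  : ∀ {x zs} → WellFormedAction (input x zs)
    τ      : WellFormedAction τ

  record Action : Set where
    constructor _,_
    field
      label      : RawAction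
      wellFormed : WellFormedAction label

  open Action public using (label)

  swapAction : Name → Name → Action → Action
  swapAction a b (β , w) = swap a b β , go w
    where
    go : ∀ {β} → WellFormedAction β → WellFormedAction (swap a b β)
    go (output u s z∉) =
      output (swap-Unique a b u) (⊆.map⁺ (swapName a b) s) (swap-∉ a b z∉)
    go input = input
    go τ     = τ

  infix 4 _≈ₐ_

  data _≈ₐ_ : RawAction → RawAction → Set where
    output : ∀ {ys′ ys″ z ys} → ys′ ↭ ys″ → output ys′ z ys ≈ₐ output ys″ z ys
    input  : ∀ {x zs} → input x zs ≈ₐ input x zs
    τ      : τ ≈ₐ τ

  infix 4 _—[_]→_

  -- agents-α and actions-≈ say that processes are taken up to α-equivalence and
  -- actions up to reordering of bound names. bound-α is α-conversion of the bound
  -- names of an output, exactly as for psi-calculus transitions.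
  data _—[_]→_ : Agent → RawAction → Agent → Set where
    agents-α : ∀ {P P₁ β P₁′ P′} → P =α P₁ → P₁ —[ β ]→ P₁′ → P₁′ =α P′ → P —[ β ]→ P′

    actions-≈ : ∀ {P β β′ P′} → P —[ β ]→ P′ → β ≈ₐ β′ → P —[ β′ ]→ P′

    bound-α : ∀ {P ys′ z ys P′ a b} → P —[ output ys′ z ys ]→ P′ →
              a ∈ ys′ → b ≢ z → b # ys → b # P′ →
              P —[ output (swap a b ys′) z (swap a b ys) ]→ swap a b P′

    Out : ∀ {x ys P} → output x ys P —[ output [] x ys ]→ P

    In : ∀ {x ys zs P} → length zs ≡ length ys →
         input x ys P —[ input x zs ]→ substitute (id [ ys ≔ zs ]) P

    Sumˡ : ∀ {P Q β P′} → P —[ β ]→ P′ → P ⊕ Q —[ β ]→ P′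
    Sumʳ : ∀ {P Q β Q′} → Q —[ β ]→ Q′ → P ⊕ Q —[ β ]→ Q′

    Match : ∀ {x P β P′} → P —[ β ]→ P′ → match x x P —[ β ]→ P′

    Parˡ : ∀ {P Q β P′} → P —[ β ]→ P′ → bn β #* Q → P ∣ Q —[ β ]→ P′ ∣ Q
    Parʳ : ∀ {P Q β Q′} → Q —[ β ]→ Q′ → bn β #* P → P ∣ Q —[ β ]→ P ∣ Q′

    Res : ∀ {x P β P′} → P —[ β ]→ P′ → x # β → ν x P —[ β ]→ ν x P′

    Rep : ∀ {P β P′} → P ∣ ! P —[ β ]→ P′ → ! P —[ β ]→ P′

    Comˡ : ∀ {P Q P′ Q′ x ys′ ys} →
           P —[ output ys′ x ys ]→ P′ → Q —[ input x ys ]→ Q′ → ys′ #* Q →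
           P ∣ Q —[ τ ]→ ν* ys′ (P′ ∣ Q′)

    Comʳ : ∀ {P Q P′ Q′ x ys′ ys} →
           P —[ input x ys ]→ P′ → Q —[ output ys′ x ys ]→ Q′ → ys′ #* P →
           P ∣ Q —[ τ ]→ ν* ys′ (P′ ∣ Q′)

    Open : ∀ {P P′ x ys′ z ys} → P —[ output ys′ z ys ]→ P′ →
           x ≢ z → x ∈ ys → x ∉ ys′ → ν x P —[ output (x ∷ ys′) z ys ]→ P′

  data Constructor : ℕ → Set where
    𝟎      : Constructor 0
    input  : Name → (ys : List Name) → Unique ys → Constructor 1
    output : Name → List Name → Constructor 1
    match  : Name → Name → Constructor 1
    ν      : Name → Constructor 1
    rep    : Constructor 1
    par    : Constructor 2
    sum    : Constructor 2

  swapConstructor : ∀ {k} → Name → Name → Constructor k → Constructor k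
  swapConstructor a b 𝟎              = 𝟎
  swapConstructor a b (input x ys u) = input (swap a b x) (swap a b ys) (swap-Unique a b u)
  swapConstructor a b (output x ys)  = output (swap a b x) (swap a b ys)
  swapConstructor a b (match c d)    = match (swap a b c) (swap a b d)
  swapConstructor a b (ν x)          = ν (swap a b x)
  swapConstructor a b rep            = rep
  swapConstructor a b par            = par
  swapConstructor a b sum            = sum

  construct : ∀ {k} → Constructor k → Vec Process k → Process
  construct 𝟎              []                      = 𝟎 , 𝟎
  construct (input x ys u) ((P , w) ∷ [])          = input x ys P , input u w
  construct (output x ys)  ((P , w) ∷ [])          = output x ys P , output w
  construct (match a b)    ((P , w) ∷ [])          = match a b P , match w
  construct (ν x)          ((P , w) ∷ [])          = ν x P , ν w
  construct rep            ((P , w) ∷ [])          = ! P , ! w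
  construct par            ((P , w) ∷ (Q , v) ∷ []) = P ∣ Q , (w ∣ v)
  construct sum            ((P , w) ∷ (Q , v) ∷ []) = P ⊕ Q , (w ⊕ v)

  agentSetoid : Setoid 0ℓ 0ℓ
  agentSetoid = record
    { Carrier = Agent ; _≈_ = _=α_
    ; isEquivalence = record { refl = refl ; sym = sym ; trans = trans } }

  actionSetoid : Setoid 0ℓ 0ℓ
  actionSetoid = record
    { Carrier = RawAction ; _≈_ = _≈ₐ_
    ; isEquivalence = record
        { refl = λ { {output _ _ _} → output ↭-refl ; {input _ _} → input ; {τ} → τ }
        ; sym = λ { (output p) → output (↭-sym p) ; input → input ; τ → τ }
        ; trans = λ { (output p) (output q) → output (↭-trans p q)
                    ; input input → input ; τ τ → τ } } }

polyadicPi : ProcessCalculus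
polyadicPi = record
  { processes       = On.setoid agentSetoid agent
  ; actions         = On.setoid actionSetoid label
  ; swapProcess     = λ a b (P , w) → swap a b P , swap-WellFormed a b w
  ; swapAction      = swapAction
  ; Constructor     = Constructor
  ; swapConstructor = swapConstructor
  ; construct       = construct
  ; Transition      = λ P β P′ → agent P —[ label β ]→ agent P′
  }
  where open PolyadicPi

module Submission where

-- The encoding is the homomorphic one: an input x(ys).P becomes an input with the pattern ys
-- whose variables are listed in the order of the pattern, a match becomes a case with a single
-- branch, and a sum becomes a case with two branches guarded by the true condition. Every
-- transition on one side is then a transition on the other by the corresponding rule. The
-- order of the bound names of outputs is no obstacle: it is immaterial in the pi-calculus by
-- definition, and in the psi-calculus they can be permuted too (reorder).
--
-- For completeness the encoding is inverted. An input whose variables are listed in another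
-- order than in its pattern is read as an input of the pattern, an assertion as 0, and a case
-- as the sum of its branches. There a branch with condition true is read as its agent, a
-- branch with condition a = b as a match, and a branch with condition false as an output on a
-- restricted name, which has the same free names and no transitions.
--
-- Both directions are instances of a single relation between pi-calculus and psi-calculus
-- agents, p represents P, written p ∝[ m ] P. In mode exact it is the graph of the encoding on
-- well-formed agents (encode-∝, exact-encode), and in mode loose it contains the inverse
-- translation just described, so that every well-formed psi-calculus agent is represented
-- (decode). The relation is defined structurally, without alpha-equivalence, and for both
-- modes at once it
--   * preserves free names, hence all freshness side conditions (∝-names⁺, ∝-names⁻),
--   * commutes with alpha-equivalence on either side (∝-αˡ⁺, ∝-αʳ⁺ and their converses),
--   * is preserved by substitution up to alpha-equivalence (∝-substitute), and
--   * is a strong bisimulation between the two transition systems (forward, backward).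
-- The clauses on transitions of a representation are forward and backward in mode exact; the
-- derivatives are even syntactically equal, a special case of structural congruence.
-- Psi-calculus agents loosely represented by alpha-equivalent pi-calculus agents are bisimilar,
-- by composing backward with forward, and stay so related under substitution. In particular,
-- each psi-calculus agent is congruent to the encoding of any well-formed pi-calculus agent
-- that represents it.
--
-- What remains is the theory of alpha-equivalence for polyadic pi-calculus agents. Since
-- substitute chooses bound names by a rule that is not equivariant, the facts needed about it
-- (independence of that choice, compatibility with alpha-equivalence) all come from one
-- lemma, rename-substitute.

open import Defs

open import Data.Empty using (⊥; ⊥-elim)
open import Data.Nat.Base using (suc; _≤_; _⊔_)
open import Data.Nat.Properties
  using (_≟_; ≤-trans; m≤m⊔n; m≤n⊔m; m≤m+n; 1+n≰n; suc-injective)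
open import Data.Product.Base using (Σ; ∃-syntax; _×_; _,_; proj₁; proj₂)
open import Data.Sum.Base using (inj₁; inj₂)
open import Data.Vec.Base as Vec using (Vec; []; _∷_)
open import Data.List.Base using (List; []; _∷_; [_]; _++_; map; foldr; length)
open import Data.List.Properties
  using (map-∘; map-cong; map-cong-local; map-id; map-id-local; length-map)
open import Data.List.Membership.Propositional using (_∈_; _∉_)
open import Data.List.Membership.Propositional.Properties
  using (∈-map⁺; ∈-map⁻; ∈-++⁺ˡ; ∈-++⁺ʳ; ∈-++⁻; ∈-filter⁺; ∈-filter⁻; ∈-∃++)
open import Data.List.Membership.DecPropositional _≟_ using (_∈?_; _∉?_)
open import Data.List.Relation.Unary.All as All using ([]; _∷_)
open import Data.List.Relation.Unary.Any using (here; there)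
open import Data.List.Relation.Unary.AllPairs using ([]; _∷_)
open import Data.List.Relation.Unary.Unique.Propositional using (Unique)
import Data.List.Relation.Unary.Unique.Propositional.Properties as Unique
open import Data.List.Relation.Binary.Subset.Propositional using (_⊆_)
open import Data.List.Relation.Binary.Permutation.Propositional
  using (_↭_; ↭-refl; ↭-sym; ↭-trans)
open import Data.List.Relation.Binary.Permutation.Propositional.Properties as ↭
  using (∈-resp-↭; All-resp-↭; ↭-empty-inv; shift; drop-mid)
open import Function.Base using (id; _∘_)
open import Function.Bundles using (mk⇔; Equivalence)
open import Function.Definitions using (Injective)
open import Relation.Nullary.Decidable.Core using (yes; no)
open import Relation.Binary.PropositionalEquality
  using (_≡_; _≢_; refl; cong; cong₂; subst; module ≡-Reasoning)
  renaming (sym to ≡-sym; trans to ≡-trans)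

open PolyadicPi
  using ( fn; 𝟎; input; output; match; ν; !_; _∣_; _⊕_; τ
        ; refl; sym; trans; rename-ν; rename-input
        ; agents-α; actions-≈; bound-α; Out; In; Sumˡ; Sumʳ; Match; Parˡ; Parʳ; Res; Rep
        ; Comˡ; Comʳ; Open; rep; par; sum; _≈ₐ_ )
  renaming ( Agent to Agentπ; substitute to substituteπ; ν* to ν*π; _=α_ to _=π_
           ; _—[_]→_ to _—π[_]→_; RawAction to Actionπ
           ; _,_ to infix 5 _,π_ )
open PPI
  using ( Condition; ⊤ᶜ; ⊥ᶜ; _≈_; Term; name; tuple; ⟨_⟩; 𝟏; _⊢_; ⊢⊤; ⊢≈; match
        ; Branches; output; input; case; ν; _∣_; !_; assertion; []; _∶_□_
        ; Guarded; Guardedᵇ; WellFormed; WellFormedᵇ; _∷_; rep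
        ; refl; sym; trans; rename-ν; rename-input; τ
        ; _∶_∈ᵇ_
        ; agents-α; bound-α; In; Out; Comˡ; Comʳ; Parˡ; Parʳ; Case; Rep; Scope; Open
        ; hole )
  renaming ( Agent to Agentψ; substitute to substituteψ; ν* to ν*ψ; _=α_ to _=ψ_
           ; here to hereᵇ; there to thereᵇ; _=αᵇ_ to _=ψᵇ_; _—[_]→_ to _—ψ[_]→_
           ; RawAction to Actionψ; _,_ to infix 5 _,ψ_ )

-- Names, fresh names and updates of functions on names

private
  variable
    a b n x z : Name
    as bs xs : List Name

Inj : (Name → Name) → Set
Inj = Injective _≡_ _≡_

∈-∖⁺ : z ∈ xs → z ∉ as → z ∈ xs ∖ as
∈-∖⁺ {as = as} = ∈-filter⁺ (_∉? as)

∈-∖⁻ : ∀ xs → z ∈ xs ∖ as → z ∈ xs × z ∉ as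
∈-∖⁻ {as = as} xs = ∈-filter⁻ (_∉? as) {xs = xs}

∉-single : z ≢ a → z ∉ [ a ]
∉-single z≢a (here z≡a) = z≢a z≡a

swapName-left : ∀ a b → swapName a b a ≡ b
swapName-left a b with a ≟ a
... | yes _  = refl
... | no a≢a = ⊥-elim (a≢a refl)

swapName-right : ∀ a b → swapName a b b ≡ a
swapName-right a b with b ≟ a | b ≟ b
... | yes b≡a | _     = b≡a
... | no _    | yes _ = refl
... | no _    | no b≢b = ⊥-elim (b≢b refl)

swapName-other : ∀ a b {z} → z ≢ a → z ≢ b → swapName a b z ≡ z
swapName-other a b {z} z≢a z≢b with z ≟ a | z ≟ b
... | yes z≡a | _       = ⊥-elim (z≢a z≡a)
... | no _    | yes z≡b = ⊥-elim (z≢b z≡b)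
... | no _    | no _    = refl

swap-inj : ∀ a b → Inj (swapName a b)
swap-inj a b = swapName-injective a b

∘-inj : ∀ {f g} → Inj f → Inj g → Inj (f ∘ g)
∘-inj i j eq = j (i eq)

∈-map-inj : ∀ {f} → Inj f → f z ∈ map f xs → z ∈ xs
∈-map-inj {xs = xs} {f} i p with ∈-map⁻ f p
... | w , w∈xs , eq = subst (_∈ xs) (≡-sym (i eq)) w∈xs

map-swap-involutive : ∀ a b zs → map (swapName a b) (map (swapName a b) zs) ≡ zs
map-swap-involutive a b zs =
  ≡-trans (≡-sym (map-∘ zs)) (≡-trans (map-cong (swapName-involutive a b) zs) (map-id zs))

∈-swap⁻ : ∀ a b xs → z ∈ map (swapName a b) xs → swapName a b z ∈ xs
∈-swap⁻ a b xs p with ∈-map⁻ (swapName a b) p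
... | w , w∈xs , refl = subst (_∈ xs) (≡-sym (swapName-involutive a b w)) w∈xs

≐-sym : as ≐ bs → bs ≐ as
≐-sym e = mk⇔ (Equivalence.from e) (Equivalence.to e)

≐-trans : as ≐ bs → bs ≐ xs → as ≐ xs
≐-trans d e = mk⇔ (Equivalence.to e ∘ Equivalence.to d) (Equivalence.from d ∘ Equivalence.from e)

Unique-head : Unique (a ∷ as) → a ∉ as
Unique-head (a∉ ∷ _) p = All.lookup a∉ p refl

∉-tail : a ∉ x ∷ xs → a ∉ xs
∉-tail a∉ p = a∉ (there p)

≤-max : z ∈ xs → z ≤ foldr _⊔_ 0 xs
≤-max {xs = x ∷ xs} (here refl) = m≤m⊔n x _
≤-max {xs = x ∷ xs} (there p)   = ≤-trans (≤-max p) (m≤n⊔m x _)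

suc-max-∉ : ∀ xs → suc (foldr _⊔_ 0 xs) ∉ xs
suc-max-∉ xs p = 1+n≰n (≤-max p)

fresh-∉ : ∀ xs k → z ∈ xs → z ∉ fresh xs k
fresh-∉ xs k z∈xs p with ∈-map⁻ _ p
... | i , _ , refl = 1+n≰n (≤-trans (m≤m+n _ i) (≤-max z∈xs))

≔-∉ : ∀ σ as bs → n ∉ as → (σ [ as ≔ bs ]) n ≡ σ n
≔-∉         σ []       bs       n∉ = refl
≔-∉         σ (a ∷ as) []       n∉ = refl
≔-∉ {n = n} σ (a ∷ as) (b ∷ bs) n∉ with n ≟ a
... | yes n≡a = ⊥-elim (n∉ (here n≡a))
... | no _    = ≔-∉ σ as bs (∉-tail n∉)

≔-∈ : ∀ σ as bs → length as ≡ length bs → n ∈ as → (σ [ as ≔ bs ]) n ∈ bs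
≔-∈ {n = n} σ (a ∷ as) (b ∷ bs) len n∈ with n ≟ a
... | yes _  = here refl
... | no n≢a with n∈
...   | here n≡a = ⊥-elim (n≢a n≡a)
...   | there p  = there (≔-∈ σ as bs (suc-injective len) p)

≔-map : ∀ σ as f → n ∈ as → (σ [ as ≔ map f as ]) n ≡ f n
≔-map {n = n} σ (a ∷ as) f n∈ with n ≟ a
... | yes refl = refl
... | no n≢a with n∈
...   | here n≡a = ⊥-elim (n≢a n≡a)
...   | there p  = ≔-map σ as f p

-- Two updates along the same lists agree where the updated functions do, and on as.
≔-cong : ∀ σ ρ as bs → length as ≡ length bs → (n ∉ as → σ n ≡ ρ n) →
         (σ [ as ≔ bs ]) n ≡ (ρ [ as ≔ bs ]) n
≔-cong         σ ρ []       []       len eq = eq λ ()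
≔-cong {n = n} σ ρ (a ∷ as) (b ∷ bs) len eq with n ≟ a
... | yes _  = refl
... | no n≢a = ≔-cong σ ρ as bs (suc-injective len)
                 λ n∉ → eq λ { (here n≡a) → n≢a n≡a ; (there p) → n∉ p }

-- Updates commute with functions applied to the values (≔-∘) and with injective functions
-- applied to the arguments (∘-≔).
≔-∘ : ∀ f σ as bs n → f ((σ [ as ≔ bs ]) n) ≡ ((f ∘ σ) [ as ≔ map f bs ]) n
≔-∘ f σ []       bs       n = refl
≔-∘ f σ (a ∷ as) []       n = refl
≔-∘ f σ (a ∷ as) (b ∷ bs) n with n ≟ a
... | yes _ = refl
... | no _  = ≔-∘ f σ as bs n

∘-≔ : ∀ σ {f} → Inj f → ∀ as bs n → (σ [ map f as ≔ bs ]) (f n) ≡ ((σ ∘ f) [ as ≔ bs ]) n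
∘-≔ σ     i []       bs       n = refl
∘-≔ σ     i (a ∷ as) []       n = refl
∘-≔ σ {f} i (a ∷ as) (b ∷ bs) n with f n ≟ f a | n ≟ a
... | yes _   | yes _   = refl
... | no _    | no _    = ∘-≔ σ i as bs n
... | yes eq  | no n≢a  = ⊥-elim (n≢a (i eq))
... | no neq  | yes n≡a = ⊥-elim (neq (cong f n≡a))

-- An update along xs is also an update along any list ys with the same entries, with the
-- values that it takes on ys.
≔-reorder : ∀ {σ ρ xs ys zs} → (∀ n → σ n ≡ ρ n) → xs ≐ ys → length xs ≡ length zs →
            ∀ n → (σ [ ys ≔ map (ρ [ xs ≔ zs ]) ys ]) n ≡ (ρ [ xs ≔ zs ]) n
≔-reorder {σ} {ρ} {xs} {ys} {zs} σ≗ρ xs≐ys len n with n ∈? ys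
... | yes n∈ = ≔-map σ ys _ n∈
... | no n∉  = ≡-trans (≔-∉ σ ys _ n∉) (≡-trans (σ≗ρ n)
                 (≡-sym (≔-∉ ρ xs zs λ p → n∉ (Equivalence.to xs≐ys p))))

-- Renaming polyadic pi-calculus agents along injective functions

-- f acts on every occurrence of a name, bound ones included, as swap does.
rename : (Name → Name) → Agentπ → Agentπ
rename f 𝟎               = 𝟎
rename f (input x ys p)  = input (f x) (map f ys) (rename f p)
rename f (output x ys p) = output (f x) (map f ys) (rename f p)
rename f (match a b p)   = match (f a) (f b) (rename f p)
rename f (ν x p)         = ν (f x) (rename f p)
rename f (! p)           = ! rename f p
rename f (p ∣ q)         = rename f p ∣ rename f q
rename f (p ⊕ q)         = rename f p ⊕ rename f q

swap-rename : ∀ a b p → swap a b p ≡ rename (swapName a b) p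
swap-rename a b 𝟎               = refl
swap-rename a b (input x ys p)  = cong (input _ _) (swap-rename a b p)
swap-rename a b (output x ys p) = cong (output _ _) (swap-rename a b p)
swap-rename a b (match c d p)   = cong (match _ _) (swap-rename a b p)
swap-rename a b (ν x p)         = cong (ν _) (swap-rename a b p)
swap-rename a b (! p)           = cong !_ (swap-rename a b p)
swap-rename a b (p ∣ q)         = cong₂ _∣_ (swap-rename a b p) (swap-rename a b q)
swap-rename a b (p ⊕ q)         = cong₂ _⊕_ (swap-rename a b p) (swap-rename a b q)

rename-∘ : ∀ f g p → rename f (rename g p) ≡ rename (f ∘ g) p
rename-∘ f g 𝟎               = refl
rename-∘ f g (input x ys p)  = cong₂ (input _) (≡-sym (map-∘ ys)) (rename-∘ f g p)
rename-∘ f g (output x ys p) = cong₂ (output _) (≡-sym (map-∘ ys)) (rename-∘ f g p)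
rename-∘ f g (match a b p)   = cong (match _ _) (rename-∘ f g p)
rename-∘ f g (ν x p)         = cong (ν _) (rename-∘ f g p)
rename-∘ f g (! p)           = cong !_ (rename-∘ f g p)
rename-∘ f g (p ∣ q)         = cong₂ _∣_ (rename-∘ f g p) (rename-∘ f g q)
rename-∘ f g (p ⊕ q)         = cong₂ _⊕_ (rename-∘ f g p) (rename-∘ f g q)

rename-id : ∀ {f} → (∀ n → f n ≡ n) → ∀ p → rename f p ≡ p
rename-id e 𝟎               = refl
rename-id e (input x ys p)
  rewrite e x | map-cong e ys | map-id ys = cong (input _ _) (rename-id e p)
rename-id e (output x ys p)
  rewrite e x | map-cong e ys | map-id ys = cong (output _ _) (rename-id e p)
rename-id e (match a b p) rewrite e a | e b = cong (match _ _) (rename-id e p)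
rename-id e (ν x p) rewrite e x = cong (ν _) (rename-id e p)
rename-id e (! p)           = cong !_ (rename-id e p)
rename-id e (p ∣ q)         = cong₂ _∣_ (rename-id e p) (rename-id e q)
rename-id e (p ⊕ q)         = cong₂ _⊕_ (rename-id e p) (rename-id e q)

swap-involutive : ∀ a b p → swap a b (swap a b p) ≡ p
swap-involutive a b p
  rewrite swap-rename a b p | swap-rename a b (rename (swapName a b) p)
        | rename-∘ (swapName a b) (swapName a b) p = rename-id (swapName-involutive a b) p

fn-rename⁺ : ∀ {f} → Inj f → ∀ p → n ∈ fn p → f n ∈ fn (rename f p)
fn-rename⁺ i (input x ys p) (here refl) = here refl
fn-rename⁺ i (input x ys p) (there q) with n∈ , n∉ ← ∈-∖⁻ (fn p) q =
  there (∈-∖⁺ (fn-rename⁺ i p n∈) λ q → n∉ (∈-map-inj i q))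
fn-rename⁺ i (output x ys p) (here refl) = here refl
fn-rename⁺ {f = f} i (output x ys p) (there q) with ∈-++⁻ ys q
... | inj₁ q = there (∈-++⁺ˡ (∈-map⁺ f q))
... | inj₂ q = there (∈-++⁺ʳ _ (fn-rename⁺ i p q))
fn-rename⁺ i (match a b p) (here refl)         = here refl
fn-rename⁺ i (match a b p) (there (here refl)) = there (here refl)
fn-rename⁺ i (match a b p) (there (there q))   = there (there (fn-rename⁺ i p q))
fn-rename⁺ {f = f} i (ν x p) q with n∈ , n∉ ← ∈-∖⁻ (fn p) q =
  ∈-∖⁺ (fn-rename⁺ i p n∈) λ q → n∉ (∈-map-inj {xs = [ x ]} i q)
fn-rename⁺ i (! p) q = fn-rename⁺ i p q
fn-rename⁺ i (p ∣ q) r with ∈-++⁻ (fn p) r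
... | inj₁ r = ∈-++⁺ˡ (fn-rename⁺ i p r)
... | inj₂ r = ∈-++⁺ʳ _ (fn-rename⁺ i q r)
fn-rename⁺ i (p ⊕ q) r with ∈-++⁻ (fn p) r
... | inj₁ r = ∈-++⁺ˡ (fn-rename⁺ i p r)
... | inj₂ r = ∈-++⁺ʳ _ (fn-rename⁺ i q r)

fn-rename⁻ : ∀ f p → z ∈ fn (rename f p) → ∃[ n ] n ∈ fn p × z ≡ f n
fn-rename⁻ f (input x ys p) (here refl) = x , here refl , refl
fn-rename⁻ f (input x ys p) (there q) with ∈-∖⁻ (fn (rename f p)) q
... | z∈ , z∉ with n , n∈ , refl ← fn-rename⁻ f p z∈ =
  n , there (∈-∖⁺ n∈ λ q → z∉ (∈-map⁺ f q)) , refl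
fn-rename⁻ f (output x ys p) (here refl) = x , here refl , refl
fn-rename⁻ f (output x ys p) (there q) with ∈-++⁻ (map f ys) q
... | inj₁ q with n , n∈ , refl ← ∈-map⁻ f q = n , there (∈-++⁺ˡ n∈) , refl
... | inj₂ q with n , n∈ , refl ← fn-rename⁻ f p q = n , there (∈-++⁺ʳ ys n∈) , refl
fn-rename⁻ f (match a b p) (here refl)         = a , here refl , refl
fn-rename⁻ f (match a b p) (there (here refl)) = b , there (here refl) , refl
fn-rename⁻ f (match a b p) (there (there q)) with n , n∈ , refl ← fn-rename⁻ f p q =
  n , there (there n∈) , refl
fn-rename⁻ f (ν x p) q with ∈-∖⁻ (fn (rename f p)) q
... | z∈ , z∉ with n , n∈ , refl ← fn-rename⁻ f p z∈ =
  n , ∈-∖⁺ n∈ (∉-single λ { refl → z∉ (here refl) }) , refl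
fn-rename⁻ f (! p) q = fn-rename⁻ f p q
fn-rename⁻ f (p ∣ q) r with ∈-++⁻ (fn (rename f p)) r
... | inj₁ r with n , n∈ , refl ← fn-rename⁻ f p r = n , ∈-++⁺ˡ n∈ , refl
... | inj₂ r with n , n∈ , refl ← fn-rename⁻ f q r = n , ∈-++⁺ʳ (fn p) n∈ , refl
fn-rename⁻ f (p ⊕ q) r with ∈-++⁻ (fn (rename f p)) r
... | inj₁ r with n , n∈ , refl ← fn-rename⁻ f p r = n , ∈-++⁺ˡ n∈ , refl
... | inj₂ r with n , n∈ , refl ← fn-rename⁻ f q r = n , ∈-++⁺ʳ (fn p) n∈ , refl

fn-swap⁺ : ∀ a b p → z ∈ fn p → swapName a b z ∈ fn (swap a b p)
fn-swap⁺ a b p z∈ rewrite swap-rename a b p = fn-rename⁺ (swap-inj a b) p z∈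

fn-swap⁻ : ∀ a b p → z ∈ fn (swap a b p) → swapName a b z ∈ fn p
fn-swap⁻ a b p z∈ = subst (_ ∈_) (cong fn (swap-involutive a b p)) (fn-swap⁺ a b (swap a b p) z∈)

-- b is fresh for p, so the swapping turns a, if free, into b and changes no other free name.
fn-swap-fresh : ∀ a b p → b ∉ fn p → z ≢ a → z ∈ fn p → z ∈ fn (swap a b p)
fn-swap-fresh a b p b∉ z≢a z∈ =
  subst (_∈ fn (swap a b p)) (swapName-other a b z≢a λ { refl → b∉ z∈ }) (fn-swap⁺ a b p z∈)

fn-unswap-fresh : ∀ a b p → b ∉ fn p → z ≢ b → z ∈ fn (swap a b p) → z ≢ a × z ∈ fn p
fn-unswap-fresh {z} a b p b∉ z≢b z∈ =
  z≢a , subst (_∈ fn p) (swapName-other a b z≢a z≢b) (fn-swap⁻ a b p z∈)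
  where
  z≢a : z ≢ a
  z≢a refl = b∉ (subst (_∈ fn p) (swapName-left a b) (fn-swap⁻ a b p z∈))

-- Free names are invariant under alpha-equivalence and commute with substitution

fn-α⁺ : ∀ {p q} → p =π q → fn p ⊆ fn q
fn-α⁻ : ∀ {p q} → p =π q → fn q ⊆ fn p

fn-α⁺ refl = id
fn-α⁺ (sym d) = fn-α⁻ d
fn-α⁺ (trans d e) = fn-α⁺ e ∘ fn-α⁺ d
fn-α⁺ (rename-ν {a} {b} {p} b#p) z∈ with ∈-∖⁻ (fn p) z∈
... | z∈p , z∉ = ∈-∖⁺ (fn-swap-fresh a b p b#p (z∉ ∘ here) z∈p) (∉-single λ { refl → b#p z∈p })
fn-α⁺ (rename-input a∈ b# b#p) (here eq) = here eq
fn-α⁺ (rename-input {a} {b} {ys = ys} {P = p} a∈ b# b#p) (there q) with ∈-∖⁻ (fn p) q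
... | z∈p , z∉ = there (∈-∖⁺ (fn-swap-fresh a b p b#p z≢a z∈p)
        λ r → z∉ (subst (_∈ ys) (swapName-other a b z≢a λ { refl → b#p z∈p }) (∈-swap⁻ a b ys r)))
  where z≢a = λ { refl → z∉ a∈ }
fn-α⁺ (input d) (here eq) = here eq
fn-α⁺ (input {P = p} d) (there q) with ∈-∖⁻ (fn p) q
... | z∈ , z∉ = there (∈-∖⁺ (fn-α⁺ d z∈) z∉)
fn-α⁺ (output d) (here eq) = here eq
fn-α⁺ (output {ys = ys} d) (there q) with ∈-++⁻ ys q
... | inj₁ r = there (∈-++⁺ˡ r)
... | inj₂ r = there (∈-++⁺ʳ ys (fn-α⁺ d r))
fn-α⁺ (match d) (here eq)         = here eq
fn-α⁺ (match d) (there (here eq)) = there (here eq)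
fn-α⁺ (match d) (there (there q)) = there (there (fn-α⁺ d q))
fn-α⁺ (ν {P = p} d) q with ∈-∖⁻ (fn p) q
... | z∈ , z∉ = ∈-∖⁺ (fn-α⁺ d z∈) z∉
fn-α⁺ (! d) q = fn-α⁺ d q
fn-α⁺ (_∣_ {P = p} {P′ = p′} d e) q with ∈-++⁻ (fn p) q
... | inj₁ r = ∈-++⁺ˡ (fn-α⁺ d r)
... | inj₂ r = ∈-++⁺ʳ (fn p′) (fn-α⁺ e r)
fn-α⁺ (_⊕_ {P = p} {P′ = p′} d e) q with ∈-++⁻ (fn p) q
... | inj₁ r = ∈-++⁺ˡ (fn-α⁺ d r)
... | inj₂ r = ∈-++⁺ʳ (fn p′) (fn-α⁺ e r)

fn-α⁻ refl = id
fn-α⁻ (sym d) = fn-α⁺ d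
fn-α⁻ (trans d e) = fn-α⁻ d ∘ fn-α⁻ e
fn-α⁻ (rename-ν {a} {b} {p} b#p) z∈ with ∈-∖⁻ (fn (swap a b p)) z∈
... | z∈′ , z∉ with z≢a , z∈p ← fn-unswap-fresh a b p b#p (z∉ ∘ here) z∈′ = ∈-∖⁺ z∈p (∉-single z≢a)
fn-α⁻ (rename-input a∈ b# b#p) (here eq) = here eq
fn-α⁻ (rename-input {a} {b} {ys = ys} {P = p} a∈ b# b#p) (there q)
  with ∈-∖⁻ (fn (swap a b p)) q
... | z∈′ , z∉
  with z≢a , z∈p ← fn-unswap-fresh a b p b#p
         (λ { refl → z∉ (subst (_∈ map (swapName a b) ys) (swapName-left a b) (∈-map⁺ _ a∈)) }) z∈′
  = there (∈-∖⁺ z∈p λ r → z∉ (subst (_∈ map (swapName a b) ys)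
      (swapName-other a b z≢a λ { refl → b#p z∈p }) (∈-map⁺ _ r)))
fn-α⁻ (input d) (here eq) = here eq
fn-α⁻ (input {Q = p} d) (there q) with ∈-∖⁻ (fn p) q
... | z∈ , z∉ = there (∈-∖⁺ (fn-α⁻ d z∈) z∉)
fn-α⁻ (output d) (here eq) = here eq
fn-α⁻ (output {ys = ys} d) (there q) with ∈-++⁻ ys q
... | inj₁ r = there (∈-++⁺ˡ r)
... | inj₂ r = there (∈-++⁺ʳ ys (fn-α⁻ d r))
fn-α⁻ (match d) (here eq)         = here eq
fn-α⁻ (match d) (there (here eq)) = there (here eq)
fn-α⁻ (match d) (there (there q)) = there (there (fn-α⁻ d q))
fn-α⁻ (ν {Q = p} d) q with ∈-∖⁻ (fn p) q
... | z∈ , z∉ = ∈-∖⁺ (fn-α⁻ d z∈) z∉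
fn-α⁻ (! d) q = fn-α⁻ d q
fn-α⁻ (_∣_ {P = p} {P′ = p′} d e) q with ∈-++⁻ (fn p′) q
... | inj₁ r = ∈-++⁺ˡ (fn-α⁻ d r)
... | inj₂ r = ∈-++⁺ʳ (fn p) (fn-α⁻ e r)
fn-α⁻ (_⊕_ {P = p} {P′ = p′} d e) q with ∈-++⁻ (fn p′) q
... | inj₁ r = ∈-++⁺ˡ (fn-α⁻ d r)
... | inj₂ r = ∈-++⁺ʳ (fn p) (fn-α⁻ e r)

fn-substitute⁺ : ∀ σ p → n ∈ fn p → σ n ∈ fn (substituteπ σ p)
fn-substitute⁺ σ (input x ys p) (here refl) = here refl
fn-substitute⁺ σ (input x ys p) (there q) with ∈-∖⁻ (fn p) q
... | n∈ , n∉ = there (∈-∖⁺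
  (subst (_∈ fn (substituteπ (σ [ ys ≔ cs ]) p)) (≔-∉ σ ys cs n∉) (fn-substitute⁺ _ p n∈))
  (fresh-∉ (map σ (fn p)) (length ys) (∈-map⁺ σ n∈)))
  where cs = fresh (map σ (fn p)) (length ys)
fn-substitute⁺ σ (output x ys p) (here refl) = here refl
fn-substitute⁺ σ (output x ys p) (there q) with ∈-++⁻ ys q
... | inj₁ r = there (∈-++⁺ˡ (∈-map⁺ σ r))
... | inj₂ r = there (∈-++⁺ʳ _ (fn-substitute⁺ σ p r))
fn-substitute⁺ σ (match a b p) (here refl)         = here refl
fn-substitute⁺ σ (match a b p) (there (here refl)) = there (here refl)
fn-substitute⁺ σ (match a b p) (there (there q))   = there (there (fn-substitute⁺ σ p q))
fn-substitute⁺ σ (ν x p) q with ∈-∖⁻ (fn p) q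
... | n∈ , n∉ = ∈-∖⁺
  (subst (_∈ fn (substituteπ (σ [ [ x ] ≔ [ c ] ]) p)) (≔-∉ σ [ x ] [ c ] n∉)
    (fn-substitute⁺ _ p n∈))
  (∉-single λ eq → suc-max-∉ (map σ (fn p)) (subst (_∈ map σ (fn p)) eq (∈-map⁺ σ n∈)))
  where c = suc (foldr _⊔_ 0 (map σ (fn p)))
fn-substitute⁺ σ (! p) q = fn-substitute⁺ σ p q
fn-substitute⁺ σ (p ∣ q) r with ∈-++⁻ (fn p) r
... | inj₁ r = ∈-++⁺ˡ (fn-substitute⁺ σ p r)
... | inj₂ r = ∈-++⁺ʳ _ (fn-substitute⁺ σ q r)
fn-substitute⁺ σ (p ⊕ q) r with ∈-++⁻ (fn p) r
... | inj₁ r = ∈-++⁺ˡ (fn-substitute⁺ σ p r)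
... | inj₂ r = ∈-++⁺ʳ _ (fn-substitute⁺ σ q r)

fn-substitute⁻ : ∀ σ p → z ∈ fn (substituteπ σ p) → ∃[ n ] n ∈ fn p × z ≡ σ n
fn-substitute⁻ σ (input x ys p) (here refl) = x , here refl , refl
fn-substitute⁻ σ (input x ys p) (there q)
  with ∈-∖⁻ (fn (substituteπ (σ [ ys ≔ fresh (map σ (fn p)) (length ys) ]) p)) q
... | z∈ , z∉ with n , n∈ , refl ← fn-substitute⁻ _ p z∈ = n , there (∈-∖⁺ n∈ n∉) , ≔-∉ σ ys cs n∉
  where
  cs = fresh (map σ (fn p)) (length ys)
  n∉ = λ r → z∉ (≔-∈ σ ys cs (≡-sym (length-fresh (map σ (fn p)) (length ys))) r)
fn-substitute⁻ σ (output x ys p) (here refl) = x , here refl , refl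
fn-substitute⁻ σ (output x ys p) (there q) with ∈-++⁻ (map σ ys) q
... | inj₁ q with n , n∈ , refl ← ∈-map⁻ σ q = n , there (∈-++⁺ˡ n∈) , refl
... | inj₂ q with n , n∈ , refl ← fn-substitute⁻ σ p q = n , there (∈-++⁺ʳ ys n∈) , refl
fn-substitute⁻ σ (match a b p) (here refl)         = a , here refl , refl
fn-substitute⁻ σ (match a b p) (there (here refl)) = b , there (here refl) , refl
fn-substitute⁻ σ (match a b p) (there (there q)) with n , n∈ , refl ← fn-substitute⁻ σ p q =
  n , there (there n∈) , refl
fn-substitute⁻ σ (ν x p) q
  with ∈-∖⁻ (fn (substituteπ (σ [ [ x ] ≔ [ suc (foldr _⊔_ 0 (map σ (fn p))) ] ]) p)) q
... | z∈ , z∉ with n , n∈ , refl ← fn-substitute⁻ _ p z∈ = n , ∈-∖⁺ n∈ n∉ , ≔-∉ σ [ x ] [ c ] n∉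
  where
  c  = suc (foldr _⊔_ 0 (map σ (fn p)))
  n∉ = λ r → z∉ (≔-∈ σ [ x ] [ c ] refl r)
fn-substitute⁻ σ (! p) q = fn-substitute⁻ σ p q
fn-substitute⁻ σ (p ∣ q) r with ∈-++⁻ (fn (substituteπ σ p)) r
... | inj₁ r with n , n∈ , refl ← fn-substitute⁻ σ p r = n , ∈-++⁺ˡ n∈ , refl
... | inj₂ r with n , n∈ , refl ← fn-substitute⁻ σ q r = n , ∈-++⁺ʳ (fn p) n∈ , refl
fn-substitute⁻ σ (p ⊕ q) r with ∈-++⁻ (fn (substituteπ σ p)) r
... | inj₁ r with n , n∈ , refl ← fn-substitute⁻ σ p r = n , ∈-++⁺ˡ n∈ , refl
... | inj₂ r with n , n∈ , refl ← fn-substitute⁻ σ q r = n , ∈-++⁺ʳ (fn p) n∈ , refl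

-- Alpha-conversion of a tuple of binders

-- The swappings of the a with the b at the same position, the first pair being swapped first.
swaps : List Name → List Name → Name → Name
swaps []       _        = id
swaps (a ∷ as) []       = id
swaps (a ∷ as) (b ∷ bs) = swaps as bs ∘ swapName a b

swaps-inj : ∀ as bs → Inj (swaps as bs)
swaps-inj []       bs       eq = eq
swaps-inj (a ∷ as) []       eq = eq
swaps-inj (a ∷ as) (b ∷ bs) eq = swap-inj a b (swaps-inj as bs eq)

swaps-other : ∀ as bs → n ∉ as → n ∉ bs → swaps as bs n ≡ n
swaps-other []       bs       n∉as n∉bs = refl
swaps-other (a ∷ as) []       n∉as n∉bs = refl
swaps-other (a ∷ as) (b ∷ bs) n∉as n∉bs =
  ≡-trans (cong (swaps as bs) (swapName-other a b (n∉as ∘ here) (n∉bs ∘ here)))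
          (swaps-other as bs (∉-tail n∉as) (∉-tail n∉bs))

swaps-map : ∀ as bs → length as ≡ length bs → Unique as → Unique bs →
            (∀ {z} → z ∈ as → z ∉ bs) → map (swaps as bs) as ≡ bs
swaps-map []       []       len u v dis = refl
swaps-map (a ∷ as) (b ∷ bs) len u@(_ ∷ u′) v@(_ ∷ v′) dis = cong₂ _∷_
  (≡-trans (cong (swaps as bs) (swapName-left a b))
           (swaps-other as bs (λ b∈ → dis (there b∈) (here refl)) (Unique-head v)))
  (≡-trans (≡-trans (map-∘ as) (cong (map (swaps as bs)) (map-id-local (All.tabulate fixed))))
           (swaps-map as bs (suc-injective len) u′ v′ λ p q → dis (there p) (there q)))
  where
  fixed : ∀ {z} → z ∈ as → swapName a b z ≡ z
  fixed z∈ = swapName-other a b (λ { refl → Unique-head u z∈ })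
                                (λ { refl → dis (there z∈) (here refl) })

rename-input-swaps :
  ∀ as bs {u ys} p → length as ≡ length bs → Unique as → Unique bs → as ⊆ ys →
  (∀ {z} → z ∈ bs → z ∉ ys) → (∀ {z} → z ∈ bs → z ∉ fn p) →
  input u ys p =π input u (map (swaps as bs) ys) (rename (swaps as bs) p)
rename-input-swaps [] [] {u} {ys} p len U V as⊆ bs# bs#p
  rewrite map-id ys | rename-id (λ _ → refl) p = refl
rename-input-swaps (a ∷ as) (b ∷ bs) {u} {ys} p len U@(_ ∷ U′) V@(_ ∷ V′) as⊆ bs# bs#p =
  trans (rename-input {a} {b} (as⊆ (here refl)) (bs# (here refl)) (bs#p (here refl)))
        (subst (λ R → input u (map s ys) (swap a b p) =π R)
           (cong₂ (input u) (≡-sym (map-∘ ys))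
             (≡-trans (cong (rename (swaps as bs)) (swap-rename a b p)) (rename-∘ _ s p)))
           (rename-input-swaps as bs (swap a b p) (suc-injective len) U′ V′ as⊆′ bs#′ bs#p′))
  where
  s = swapName a b

  fixed : ∀ {z} → z ∈ bs → s z ≡ z
  fixed z∈ = swapName-other a b (λ { refl → bs# (there z∈) (as⊆ (here refl)) })
                                (λ { refl → Unique-head V z∈ })

  as⊆′ : as ⊆ map s ys
  as⊆′ {z} z∈ = subst (_∈ map s ys)
    (swapName-other a b (λ { refl → Unique-head U z∈ })
                        (λ { refl → bs# (here refl) (as⊆ (there z∈)) }))
    (∈-map⁺ s (as⊆ (there z∈)))

  bs#′ : ∀ {z} → z ∈ bs → z ∉ map s ys
  bs#′ z∈ q = bs# (there z∈) (subst (_∈ ys) (fixed z∈) (∈-swap⁻ a b ys q))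

  bs#p′ : ∀ {z} → z ∈ bs → z ∉ fn (swap a b p)
  bs#p′ z∈ q = bs#p (there z∈) (subst (_∈ fn p) (fixed z∈) (fn-swap⁻ a b p q))

-- The tuples as and bs may overlap: the binders are first moved to names es away from both.
-- Apart from mapping as to bs, the renaming κ is only known to fix those of the given names ns
-- that are outside as and bs.
rename-binders :
  ∀ as bs ns p → length as ≡ length bs → Unique as → Unique bs →
  (∀ {z} → z ∈ bs → z ∈ fn p → z ∈ as) →
  ∃[ κ ] Inj κ × (∀ u → input u as p =π input u bs (rename κ p)) × map κ as ≡ bs
       × (∀ {n} → n ∈ ns → n ∉ as → n ∉ bs → κ n ≡ n)
rename-binders as bs ns p len U V bs#p =
  κ , ∘-inj {f = κ₂} {g = κ₁} (swaps-inj es bs) (swaps-inj as es) , convert , onto , fixed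
  where
  zs = as ++ bs ++ fn p ++ ns
  es = fresh zs (length as)
  κ₁ = swaps as es
  κ₂ = swaps es bs
  κ  = κ₂ ∘ κ₁

  E : Unique es
  E = fresh-Unique zs (length as)

  len₁ : length as ≡ length es
  len₁ = ≡-sym (length-fresh zs (length as))

  es# : ∀ {z} → z ∈ zs → z ∉ es
  es# = fresh-∉ zs (length as)

  as#es : ∀ {z} → z ∈ as → z ∉ es
  as#es z∈ = es# (∈-++⁺ˡ z∈)

  bs#es : ∀ {z} → z ∈ bs → z ∉ es
  bs#es z∈ = es# (∈-++⁺ʳ as (∈-++⁺ˡ z∈))

  p#es : ∀ {z} → z ∈ fn p → z ∉ es
  p#es z∈ = es# (∈-++⁺ʳ as (∈-++⁺ʳ bs (∈-++⁺ˡ z∈)))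

  onto₁ : map κ₁ as ≡ es
  onto₁ = swaps-map as es len₁ U E as#es

  onto₂ : map κ₂ es ≡ bs
  onto₂ = swaps-map es bs (≡-trans (≡-sym len₁) len) E V λ z∈es z∈bs → bs#es z∈bs z∈es

  onto : map κ as ≡ bs
  onto = ≡-trans (map-∘ as) (≡-trans (cong (map κ₂) onto₁) onto₂)

  bs#p′ : ∀ {z} → z ∈ bs → z ∉ fn (rename κ₁ p)
  bs#p′ z∈bs q with fn-rename⁻ κ₁ p q
  ... | n , n∈ , refl with n ∈? as
  ...   | yes n∈as = bs#es z∈bs (subst (κ₁ n ∈_) onto₁ (∈-map⁺ κ₁ n∈as))
  ...   | no n∉as  =
    n∉as (bs#p (subst (_∈ bs) (swaps-other as es n∉as (p#es n∈)) z∈bs) n∈)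

  convert : ∀ u → input u as p =π input u bs (rename κ p)
  convert u = trans
    (subst (λ es → input u as p =π input u es (rename κ₁ p)) onto₁
      (rename-input-swaps as es p len₁ U E id (λ z∈es z∈as → as#es z∈as z∈es)
        λ z∈es z∈p → p#es z∈p z∈es))
    (subst (input u es (rename κ₁ p) =π_) (cong₂ (input u) onto₂ (rename-∘ κ₂ κ₁ p))
      (rename-input-swaps es bs (rename κ₁ p) (≡-trans (≡-sym len₁) len) E V id bs#es bs#p′))

  fixed : ∀ {n} → n ∈ ns → n ∉ as → n ∉ bs → κ n ≡ n
  fixed n∈ n∉as n∉bs = ≡-trans (cong κ₂ (swaps-other as es n∉as n∉es)) (swaps-other es bs n∉es n∉bs)
    where n∉es = es# (∈-++⁺ʳ as (∈-++⁺ʳ bs (∈-++⁺ʳ (fn p) n∈)))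

-- The analogue of rename-binders for a restriction, where a and b may be equal.
rename-binder : ∀ a b p → (b ∈ fn p → b ≡ a) →
  ∃[ κ ] Inj κ × ν a p =π ν b (rename κ p) × κ a ≡ b × (∀ {n} → n ≢ a → n ≢ b → κ n ≡ n)
rename-binder a b p b#p with b ≟ a
... | yes refl = id , id , subst (ν a p =π_) (cong (ν a) (≡-sym (rename-id (λ _ → refl) p))) refl
                    , refl , λ _ _ → refl
... | no b≢a   = swapName a b , swap-inj a b
                    , subst (λ q → ν a p =π ν b q) (swap-rename a b p) (rename-ν (b≢a ∘ b#p))
                    , swapName-left a b , swapName-other a b

-- Substitution of polyadic pi-calculus agents up to alpha-equivalence

-- Substitution is equivariant in its result (π) and in its argument (θ) at once. The two
-- companion lemmas on binders allow any sufficiently fresh bound names (cs and ds, c and d) on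
-- the two sides, because those that substitute chooses are not chosen equivariantly.
rename-substitute :
  ∀ {π θ ρ ρ′} p → Inj π → Inj θ → (∀ {n} → n ∈ fn p → π (ρ n) ≡ ρ′ (θ n)) →
  rename π (substituteπ ρ p) =π substituteπ ρ′ (rename θ p)

rename-substitute-input :
  ∀ {π θ ρ ρ′} ys p cs ds → Inj π → Inj θ → Unique cs → Unique ds →
  length ys ≡ length cs → length ys ≡ length ds →
  (∀ {n} → n ∈ fn p → n ∉ ys → ρ n ∉ cs) → (∀ {n} → n ∈ fn p → n ∉ ys → ρ′ (θ n) ∉ ds) →
  (∀ {n} → n ∈ fn p → n ∉ ys → π (ρ n) ≡ ρ′ (θ n)) → ∀ u →
  input u (map π cs) (rename π (substituteπ (ρ [ ys ≔ cs ]) p)) =π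
  input u ds (substituteπ (ρ′ [ map θ ys ≔ ds ]) (rename θ p))

rename-substitute-ν :
  ∀ {π θ ρ ρ′} x p c d → Inj π → Inj θ →
  (∀ {n} → n ∈ fn p → n ≢ x → ρ n ≢ c) → (∀ {n} → n ∈ fn p → n ≢ x → ρ′ (θ n) ≢ d) →
  (∀ {n} → n ∈ fn p → n ≢ x → π (ρ n) ≡ ρ′ (θ n)) →
  ν (π c) (rename π (substituteπ (ρ [ [ x ] ≔ [ c ] ]) p)) =π
  ν d (substituteπ (ρ′ [ [ θ x ] ≔ [ d ] ]) (rename θ p))

rename-substitute-input {π} {θ} {ρ} {ρ′} ys p cs ds π-inj θ-inj C D len len′ cs# ds# eq u
  with rename-binders (map π cs) ds (map (π ∘ ρ) (fn p)) q
         (≡-trans (length-map π cs) (≡-trans (≡-sym len) len′)) (Unique.map⁺ π-inj C) D free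
  where
  q = rename π (substituteπ (ρ [ ys ≔ cs ]) p)

  free : ∀ {z} → z ∈ ds → z ∈ fn q → z ∈ map π cs
  free z∈ds z∈q with fn-rename⁻ π (substituteπ (ρ [ ys ≔ cs ]) p) z∈q
  ... | y , y∈ , refl with fn-substitute⁻ (ρ [ ys ≔ cs ]) p y∈
  ... | n , n∈ , refl with n ∈? ys
  ... | yes n∈ys = ∈-map⁺ π (≔-∈ ρ ys cs len n∈ys)
  ... | no n∉ys  = ⊥-elim (ds# n∈ n∉ys
    (subst (_∈ ds) (≡-trans (cong π (≔-∉ ρ ys cs n∉ys)) (eq n∈ n∉ys)) z∈ds))
... | κ , κ-inj , convert , onto , fixed = trans (convert u) (input
  (subst (_=π substituteπ (ρ′ [ map θ ys ≔ ds ]) (rename θ p)) (≡-sym (rename-∘ κ π _))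
    (rename-substitute p (∘-inj {f = κ} {g = π} κ-inj π-inj) θ-inj agree)))
  where
  agree : ∀ {n} → n ∈ fn p → κ (π ((ρ [ ys ≔ cs ]) n)) ≡ (ρ′ [ map θ ys ≔ ds ]) (θ n)
  agree {n} n∈ = begin
    κ (π ((ρ [ ys ≔ cs ]) n))                   ≡⟨ ≔-∘ (κ ∘ π) ρ ys cs n ⟩
    ((κ ∘ π ∘ ρ) [ ys ≔ map (κ ∘ π) cs ]) n
      ≡⟨ cong (λ zs → ((κ ∘ π ∘ ρ) [ ys ≔ zs ]) n) (≡-trans (map-∘ cs) onto) ⟩
    ((κ ∘ π ∘ ρ) [ ys ≔ ds ]) n                 ≡⟨ ≔-cong _ _ ys ds len′ outside ⟩
    ((ρ′ ∘ θ) [ ys ≔ ds ]) n                    ≡⟨ ∘-≔ ρ′ θ-inj ys ds n ⟨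
    (ρ′ [ map θ ys ≔ ds ]) (θ n)                ∎
    where
    open ≡-Reasoning

    outside : n ∉ ys → κ (π (ρ n)) ≡ ρ′ (θ n)
    outside n∉ = ≡-trans
      (fixed (∈-map⁺ (π ∘ ρ) n∈) (λ r → cs# n∈ n∉ (∈-map-inj π-inj r))
        λ r → ds# n∈ n∉ (subst (_∈ ds) (eq n∈ n∉) r))
      (eq n∈ n∉)

rename-substitute-ν {π} {θ} {ρ} {ρ′} x p c d π-inj θ-inj c# d# eq
  with rename-binder (π c) d q free
  where
  q = rename π (substituteπ (ρ [ [ x ] ≔ [ c ] ]) p)

  free : d ∈ fn q → d ≡ π c
  free d∈q with fn-rename⁻ π (substituteπ (ρ [ [ x ] ≔ [ c ] ]) p) d∈q
  ... | y , y∈ , refl with fn-substitute⁻ (ρ [ [ x ] ≔ [ c ] ]) p y∈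
  ... | n , n∈ , refl with n ≟ x
  ... | yes refl = refl
  ... | no n≢x   = ⊥-elim (d# n∈ n≢x (≡-sym (eq n∈ n≢x)))
... | κ , κ-inj , convert , onto , fixed = trans convert (ν
  (subst (_=π substituteπ (ρ′ [ [ θ x ] ≔ [ d ] ]) (rename θ p)) (≡-sym (rename-∘ κ π _))
    (rename-substitute p (∘-inj {f = κ} {g = π} κ-inj π-inj) θ-inj agree)))
  where
  agree : ∀ {n} → n ∈ fn p →
          κ (π ((ρ [ [ x ] ≔ [ c ] ]) n)) ≡ (ρ′ [ [ θ x ] ≔ [ d ] ]) (θ n)
  agree {n} n∈ with n ≟ x | θ n ≟ θ x
  ... | yes _    | yes _   = onto
  ... | yes refl | no θ≢   = ⊥-elim (θ≢ refl)
  ... | no n≢x   | yes θ≡  = ⊥-elim (n≢x (θ-inj θ≡))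
  ... | no n≢x   | no _    = ≡-trans
    (fixed (λ r → c# n∈ n≢x (π-inj r)) λ r → d# n∈ n≢x (≡-trans (≡-sym (eq n∈ n≢x)) r))
    (eq n∈ n≢x)

rename-substitute 𝟎 i j eq = refl
rename-substitute {π} {θ} {ρ} {ρ′} (input x ys p) i j eq rewrite eq (here refl) =
  rename-substitute-input ys p
    (fresh cs (length ys)) (fresh ds (length (map θ ys))) i j
    (fresh-Unique cs _) (fresh-Unique ds _) (≡-sym (length-fresh cs _))
    (≡-trans (≡-sym (length-map θ ys)) (≡-sym (length-fresh ds _)))
    (λ n∈ _ → fresh-∉ cs _ (∈-map⁺ ρ n∈))
    (λ n∈ _ → fresh-∉ ds _ (∈-map⁺ ρ′ (fn-rename⁺ j p n∈)))
    (λ n∈ n∉ → eq (there (∈-∖⁺ n∈ n∉))) _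
  where
  cs = map ρ (fn p)
  ds = map ρ′ (fn (rename θ p))
rename-substitute {π} {θ} {ρ} {ρ′} (output x ys p) i j eq
  rewrite eq (here refl) | ≡-sym (map-∘ {g = π} {f = ρ} ys) | ≡-sym (map-∘ {g = ρ′} {f = θ} ys)
        | map-cong-local {xs = ys} (All.tabulate (eq ∘ there ∘ ∈-++⁺ˡ))
  = output (rename-substitute p i j (eq ∘ there ∘ ∈-++⁺ʳ ys))
rename-substitute (match a b p) i j eq
  rewrite eq (here refl) | eq (there (here refl)) =
  match (rename-substitute p i j (eq ∘ there ∘ there))
rename-substitute {π} {θ} {ρ} {ρ′} (ν x p) i j eq =
  rename-substitute-ν x p _ _ i j
    (λ n∈ _ r → suc-max-∉ cs (subst (_∈ cs) r (∈-map⁺ ρ n∈)))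
    (λ n∈ _ r → suc-max-∉ ds (subst (_∈ ds) r (∈-map⁺ ρ′ (fn-rename⁺ j p n∈))))
    (λ n∈ n≢x → eq (∈-∖⁺ n∈ (∉-single n≢x)))
  where
  cs = map ρ (fn p)
  ds = map ρ′ (fn (rename θ p))
rename-substitute (! p) i j eq = ! rename-substitute p i j eq
rename-substitute (p ∣ q) i j eq =
  rename-substitute p i j (eq ∘ ∈-++⁺ˡ) ∣ rename-substitute q i j (eq ∘ ∈-++⁺ʳ (fn p))
rename-substitute (p ⊕ q) i j eq =
  rename-substitute p i j (eq ∘ ∈-++⁺ˡ) ⊕ rename-substitute q i j (eq ∘ ∈-++⁺ʳ (fn p))

-- The result of a substitution does not depend on the names chosen for the binders.

substitute-input-choice :
  ∀ {ρ} ys p cs ds → Unique cs → Unique ds → length ys ≡ length cs → length ys ≡ length ds →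
  (∀ {n} → n ∈ fn p → n ∉ ys → ρ n ∉ cs) → (∀ {n} → n ∈ fn p → n ∉ ys → ρ n ∉ ds) → ∀ {u} →
  input u cs (substituteπ (ρ [ ys ≔ cs ]) p) =π input u ds (substituteπ (ρ [ ys ≔ ds ]) p)
substitute-input-choice {ρ} ys p cs ds C D len len′ cs# ds# {u}
  with rename-substitute-input {id} {id} {ρ} ys p cs ds id id C D len len′ cs# ds# (λ _ _ → refl) u
... | d rewrite map-id cs | map-id ys | rename-id (λ _ → refl) p
              | rename-id (λ _ → refl) (substituteπ (ρ [ ys ≔ cs ]) p) = d

substitute-ν-choice :
  ∀ {ρ} x p c d → (∀ {n} → n ∈ fn p → n ≢ x → ρ n ≢ c) → (∀ {n} → n ∈ fn p → n ≢ x → ρ n ≢ d) →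
  ν c (substituteπ (ρ [ [ x ] ≔ [ c ] ]) p) =π ν d (substituteπ (ρ [ [ x ] ≔ [ d ] ]) p)
substitute-ν-choice {ρ} x p c d c# d#
  with rename-substitute-ν {id} {id} {ρ} x p c d id id c# d# (λ _ _ → refl)
... | e rewrite rename-id (λ _ → refl) p
              | rename-id (λ _ → refl) (substituteπ (ρ [ [ x ] ≔ [ c ] ]) p) = e

substitute-α : ∀ σ {p q} → p =π q → substituteπ σ p =π substituteπ σ q
substitute-α σ refl        = refl
substitute-α σ (sym d)     = sym (substitute-α σ d)
substitute-α σ (trans d e) = trans (substitute-α σ d) (substitute-α σ e)
substitute-α σ (rename-ν {a} {b} {p} b#p)
  with rename-substitute {id} {swapName a b} {σ} {σ} (ν a p) id (swap-inj a b)
         (λ {n} n∈ → cong σ (≡-sym (swapName-other a b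
           (λ { refl → proj₂ (∈-∖⁻ (fn p) n∈) (here refl) })
           (λ { refl → b#p (proj₁ (∈-∖⁻ (fn p) n∈)) }))))
... | d rewrite rename-id (λ _ → refl) (substituteπ σ (ν a p)) | swapName-left a b
              | swap-rename a b p = d
substitute-α σ (rename-input {a} {b} {x} {ys} {p} a∈ b# b#p)
  with rename-substitute-input {id} {swapName a b} {σ} {σ} ys p
         (fresh cs (length ys)) (fresh ds (length (map (swapName a b) ys))) id (swap-inj a b)
         (fresh-Unique cs _) (fresh-Unique ds _) (≡-sym (length-fresh cs _))
         (≡-trans (≡-sym (length-map (swapName a b) ys)) (≡-sym (length-fresh ds _)))
         (λ n∈ _ → fresh-∉ cs _ (∈-map⁺ σ n∈))
         (λ n∈ _ → fresh-∉ ds _ (∈-map⁺ σ (fn-rename⁺ (swap-inj a b) p n∈)))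
         (λ n∈ n∉ → cong σ (≡-sym (swapName-other a b (λ { refl → n∉ a∈ }) λ { refl → b#p n∈ })))
         (σ x)
  where
  cs = map σ (fn p)
  ds = map σ (fn (rename (swapName a b) p))
... | d rewrite map-id (fresh (map σ (fn p)) (length ys))
              | rename-id (λ _ → refl) (substituteπ (σ [ ys ≔ fresh (map σ (fn p)) (length ys) ]) p)
              | swap-rename a b p = d
substitute-α σ (input {x} {ys} {p} {q} d) = trans
  (substitute-input-choice ys p (fresh cs _) (fresh ds _) (fresh-Unique cs _) (fresh-Unique ds _)
    (≡-sym (length-fresh cs _)) (≡-sym (length-fresh ds _))
    (λ n∈ _ → fresh-∉ cs _ (∈-map⁺ σ n∈)) (λ n∈ _ → fresh-∉ ds _ (∈-map⁺ σ (fn-α⁺ d n∈))))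
  (input (substitute-α _ d))
  where
  cs = map σ (fn p)
  ds = map σ (fn q)
substitute-α σ (output d) = output (substitute-α σ d)
substitute-α σ (match d)  = match (substitute-α σ d)
substitute-α σ (ν {x} {p} {q} d) = trans
  (substitute-ν-choice x p _ _
    (λ n∈ _ r → suc-max-∉ cs (subst (_∈ cs) r (∈-map⁺ σ n∈)))
    (λ n∈ _ r → suc-max-∉ ds (subst (_∈ ds) r (∈-map⁺ σ (fn-α⁺ d n∈)))))
  (ν (substitute-α _ d))
  where
  cs = map σ (fn p)
  ds = map σ (fn q)
substitute-α σ (! d)   = ! substitute-α σ d
substitute-α σ (d ∣ e) = substitute-α σ d ∣ substitute-α σ e
substitute-α σ (d ⊕ e) = substitute-α σ d ⊕ substitute-α σ e

-- Psi-calculus agents: swapping, guardedness and branches of a case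

private
  variable
    p q p′ : Agentπ
    P Q P′ : Agentψ
    bs₁ bs₂ bs₃ : Branches

swapTerm-involutive : ∀ a b (M : Term) → swap a b (swap a b M) ≡ M
swapTerm-involutive a b (name c)   = cong name (swapName-involutive a b c)
swapTerm-involutive a b (tuple cs) = cong tuple (map-swap-involutive a b cs)

swapCondition-involutive : ∀ a b (φ : Condition) → swap a b (swap a b φ) ≡ φ
swapCondition-involutive a b ⊤ᶜ      = refl
swapCondition-involutive a b ⊥ᶜ      = refl
swapCondition-involutive a b (c ≈ d) =
  cong₂ _≈_ (swapName-involutive a b c) (swapName-involutive a b d)

swapψ-involutive  : ∀ a b (P : Agentψ) → swap a b (swap a b P) ≡ P
swapψᵇ-involutive : ∀ a b (bs : Branches) → swap a b (swap a b bs) ≡ bs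

swapψ-involutive a b (output M N P)
  rewrite swapTerm-involutive a b M | swapTerm-involutive a b N =
  cong (output M N) (swapψ-involutive a b P)
swapψ-involutive a b (input M xs ⟨ ys ⟩ P)
  rewrite swapTerm-involutive a b M | map-swap-involutive a b xs | map-swap-involutive a b ys =
  cong (input M xs ⟨ ys ⟩) (swapψ-involutive a b P)
swapψ-involutive a b (case bs)     = cong case (swapψᵇ-involutive a b bs)
swapψ-involutive a b (ν c P)       = cong₂ ν (swapName-involutive a b c) (swapψ-involutive a b P)
swapψ-involutive a b (P ∣ Q)       = cong₂ _∣_ (swapψ-involutive a b P) (swapψ-involutive a b Q)
swapψ-involutive a b (! P)         = cong !_ (swapψ-involutive a b P)
swapψ-involutive a b (assertion Ψ) = refl

swapψᵇ-involutive a b []           = refl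
swapψᵇ-involutive a b (φ ∶ P □ bs)
  rewrite swapCondition-involutive a b φ | swapψ-involutive a b P =
  cong (φ ∶ P □_) (swapψᵇ-involutive a b bs)

Guarded-swap  : ∀ a b → Guarded P → Guarded (swap a b P)
Guardedᵇ-swap : ∀ a b → Guardedᵇ bs₁ → Guardedᵇ (swap a b bs₁)

Guarded-swap a b output    = output
Guarded-swap a b input     = input
Guarded-swap a b (case gs) = case (Guardedᵇ-swap a b gs)
Guarded-swap a b (ν g)     = ν (Guarded-swap a b g)
Guarded-swap a b (g ∣ h)   = Guarded-swap a b g ∣ Guarded-swap a b h
Guarded-swap a b (! g)     = ! Guarded-swap a b g

Guardedᵇ-swap a b []       = []
Guardedᵇ-swap a b (g ∷ gs) = Guarded-swap a b g ∷ Guardedᵇ-swap a b gs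

Guarded-unswap : ∀ a b P → Guarded (swap a b P) → Guarded P
Guarded-unswap a b P g = subst Guarded (swapψ-involutive a b P) (Guarded-swap a b g)

Guarded-α⁺  : P =ψ Q → Guarded P → Guarded Q
Guarded-α⁻  : P =ψ Q → Guarded Q → Guarded P
Guardedᵇ-α⁺ : bs₁ =ψᵇ bs₂ → Guardedᵇ bs₁ → Guardedᵇ bs₂
Guardedᵇ-α⁻ : bs₁ =ψᵇ bs₂ → Guardedᵇ bs₂ → Guardedᵇ bs₁

Guarded-α⁺ refl         g         = g
Guarded-α⁺ (sym d)      g         = Guarded-α⁻ d g
Guarded-α⁺ (trans d e)  g         = Guarded-α⁺ e (Guarded-α⁺ d g)
Guarded-α⁺ (rename-ν _) (ν g)     = ν (Guarded-swap _ _ g)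
Guarded-α⁺ (rename-input _ _ _ _) input = input
Guarded-α⁺ (output d)   output    = output
Guarded-α⁺ (input d)    input     = input
Guarded-α⁺ (case ds)    (case gs) = case (Guardedᵇ-α⁺ ds gs)
Guarded-α⁺ (ν d)        (ν g)     = ν (Guarded-α⁺ d g)
Guarded-α⁺ (d ∣ e)      (g ∣ h)   = Guarded-α⁺ d g ∣ Guarded-α⁺ e h
Guarded-α⁺ (! d)        (! g)     = ! Guarded-α⁺ d g

Guarded-α⁻ refl         g         = g
Guarded-α⁻ (sym d)      g         = Guarded-α⁺ d g
Guarded-α⁻ (trans d e)  g         = Guarded-α⁻ d (Guarded-α⁻ e g)
Guarded-α⁻ (rename-ν {P = P} _) (ν g) = ν (Guarded-unswap _ _ P g)
Guarded-α⁻ (rename-input _ _ _ _) input = input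
Guarded-α⁻ (output d)   output    = output
Guarded-α⁻ (input d)    input     = input
Guarded-α⁻ (case ds)    (case gs) = case (Guardedᵇ-α⁻ ds gs)
Guarded-α⁻ (ν d)        (ν g)     = ν (Guarded-α⁻ d g)
Guarded-α⁻ (d ∣ e)      (g ∣ h)   = Guarded-α⁻ d g ∣ Guarded-α⁻ e h
Guarded-α⁻ (! d)        (! g)     = ! Guarded-α⁻ d g

Guardedᵇ-α⁺ []       []       = []
Guardedᵇ-α⁺ (d ∷ ds) (g ∷ gs) = Guarded-α⁺ d g ∷ Guardedᵇ-α⁺ ds gs

Guardedᵇ-α⁻ []       []       = []
Guardedᵇ-α⁻ (d ∷ ds) (g ∷ gs) = Guarded-α⁻ d g ∷ Guardedᵇ-α⁻ ds gs

=ψᵇ-refl : bs₁ =ψᵇ bs₁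
=ψᵇ-refl {[]}         = []
=ψᵇ-refl {φ ∶ P □ bs} = refl ∷ =ψᵇ-refl

=ψᵇ-sym : bs₁ =ψᵇ bs₂ → bs₂ =ψᵇ bs₁
=ψᵇ-sym []       = []
=ψᵇ-sym (d ∷ ds) = sym d ∷ =ψᵇ-sym ds

=ψᵇ-trans : bs₁ =ψᵇ bs₂ → bs₂ =ψᵇ bs₃ → bs₁ =ψᵇ bs₃
=ψᵇ-trans []       []       = []
=ψᵇ-trans (d ∷ ds) (e ∷ es) = trans d e ∷ =ψᵇ-trans ds es

case-α⁺ : case bs₁ =ψ Q → ∃[ bs ] Q ≡ case bs × bs₁ =ψᵇ bs
case-α⁻ : Q =ψ case bs₁ → ∃[ bs ] Q ≡ case bs × bs₁ =ψᵇ bs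

case-α⁺ refl      = _ , refl , =ψᵇ-refl
case-α⁺ (sym d)   = case-α⁻ d
case-α⁺ (case ds) = _ , refl , ds
case-α⁺ (trans d e) with _ , refl , ds ← case-α⁺ d with _ , refl , es ← case-α⁺ e =
  _ , refl , =ψᵇ-trans ds es

case-α⁻ refl      = _ , refl , =ψᵇ-refl
case-α⁻ (sym d)   = case-α⁺ d
case-α⁻ (case ds) = _ , refl , =ψᵇ-sym ds
case-α⁻ (trans d e) with _ , refl , es ← case-α⁻ e with _ , refl , ds ← case-α⁻ d =
  _ , refl , =ψᵇ-trans es ds

∈ᵇ-α : ∀ {φ} → bs₁ =ψᵇ bs₂ → φ ∶ P ∈ᵇ bs₂ → ∃[ Q ] φ ∶ Q ∈ᵇ bs₁ × Q =ψ P
∈ᵇ-α (d ∷ ds) hereᵇ = _ , hereᵇ , d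
∈ᵇ-α (d ∷ ds) (thereᵇ i) with Q , j , e ← ∈ᵇ-α ds i = Q , thereᵇ j , e

-- Every transition of a case is, up to alpha-equivalence, one of a branch with a true condition.
case-inv : ∀ {α} → case bs₁ —ψ[ α ]→ P′ →
           ∃[ φ ] ∃[ P ] φ ∶ P ∈ᵇ bs₁ × 𝟏 ⊢ φ × P —ψ[ α ]→ P′
case-inv (agents-α d t e) with _ , refl , ds ← case-α⁺ d with φ , P , i , h , t′ ← case-inv t
  with Q , j , d′ ← ∈ᵇ-α ds i = φ , Q , j , h , agents-α d′ t′ e
case-inv (bound-α t a∈ b#M b#N b#P) with φ , P , i , h , t′ ← case-inv t =
  φ , P , i , h , bound-α t′ a∈ b#M b#N b#P
case-inv (Case i t h) = _ , _ , i , h , t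

-- The bound names of an output can be reordered: Open may insert a name anywhere.
reorder : ∀ {M N} → P —ψ[ output M as N ]→ P′ → as ↭ bs → P —ψ[ output M bs N ]→ P′
reorder (agents-α d t e) r = agents-α d (reorder t r) e
reorder {bs = bs} (bound-α {as = as} {a = a} {b = b} t a∈ b#M b#N b#P) r =
  subst (λ cs → _ —ψ[ output _ cs _ ]→ _) (map-swap-involutive a b bs)
    (bound-α (reorder t r′) (∈-resp-↭ r′ a∈) b#M b#N b#P)
  where
  r′ : as ↭ map (swapName a b) bs
  r′ = subst (_↭ map (swapName a b) bs) (map-swap-involutive a b as) (↭.map⁺ (swapName a b) r)
reorder (Out h) r with refl ← ↭-empty-inv (↭-sym r) = Out h
reorder (Parˡ t as#Q) r = Parˡ (reorder t r) (All-resp-↭ r as#Q)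
reorder (Parʳ t as#P) r = Parʳ (reorder t r) (All-resp-↭ r as#P)
reorder (Case i t h) r = Case i (reorder t r) h
reorder (Rep t) r = Rep (reorder t r)
reorder {M = M} (Scope {b = b} t b#α) r =
  Scope (reorder t r) λ b∈ → b#α (move (names M) (↭-sym r) b∈)
  where
  move : ∀ ms {as bs ns : List Name} → as ↭ bs → b ∈ ms ++ as ++ ns → b ∈ ms ++ bs ++ ns
  move ms {as} {bs} r b∈ with ∈-++⁻ ms b∈
  ... | inj₁ b∈ = ∈-++⁺ˡ b∈
  ... | inj₂ b∈ with ∈-++⁻ as b∈
  ...   | inj₁ b∈ = ∈-++⁺ʳ ms (∈-++⁺ˡ (∈-resp-↭ r b∈))
  ...   | inj₂ b∈ = ∈-++⁺ʳ ms (∈-++⁺ʳ bs b∈)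
reorder (Open {as = as} {as′} {b = b} t b#as b#M b∈N) r
  with cs , cs′ , refl ← ∈-∃++ (∈-resp-↭ r (∈-++⁺ʳ as (here refl))) =
  Open (reorder t r′) (λ b∈ → b#as (∈-resp-↭ (↭-sym r′) b∈)) b#M b∈N
  where
  r′ : as ++ as′ ↭ cs ++ cs′
  r′ = drop-mid as cs r

-- Pi-calculus agents represented by psi-calculus agents

-- exact relates a pi-calculus agent to its encoding only; loose relates it also to the other
-- psi-calculus agents that are read as that agent.
data Mode : Set where
  exact loose : Mode

-- OutputAt x p: p is an output with subject x.
data OutputAt (x : Name) : Agentπ → Set where
  at : ∀ {ys p} → OutputAt x (output x ys p)

-- An output on a restricted name: it has no transitions, but it may have free names.
data Dead : Agentπ → Set where
  dead : ∀ {x p} → OutputAt x p → Dead (ν x p)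

-- The variables xs of an input list the names of its pattern ys, in the same order if m is
-- exact.
record Binders (m : Mode) (xs ys : List Name) : Set where
  constructor binders
  field
    unique-vars    : Unique xs
    unique-pattern : Unique ys
    same-names     : xs ≐ ys
    same-order     : m ≡ exact → xs ≡ ys

open Binders

infix 4 _∝[_]_ _∝⟨_⟩_

-- p ∝[ m ] P: p represents P. Guardedness is recorded under replications and in branches, so
-- that only well-formed psi-calculus agents are represented. The constructors assertion and
-- choice, and inputs with reordered variables, occur in mode loose only.
data _∝[_]_ : Agentπ → Mode → Agentψ → Set
-- p ∝⟨ φ ⟩ P: the summand p represents the branch P with condition φ.
data _∝⟨_⟩_ : Agentπ → Condition → Agentψ → Set

data _∝[_]_ where
  𝟎         : ∀ {m} → 𝟎 ∝[ m ] case []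
  assertion : ∀ {Ψ} → 𝟎 ∝[ loose ] assertion Ψ
  input     : ∀ {m x xs ys p P} → Binders m xs ys → p ∝[ m ] P →
              input x ys p ∝[ m ] input (name x) xs ⟨ ys ⟩ P
  output    : ∀ {m x ys p P} → p ∝[ m ] P → output x ys p ∝[ m ] output (name x) (tuple ys) P
  match     : ∀ {m a b p P} → Guarded P → p ∝[ m ] P →
              match a b p ∝[ m ] case (a ≈ b ∶ P □ [])
  sum       : ∀ {m p q P Q} → Guarded P → Guarded Q → p ∝[ m ] P → q ∝[ m ] Q →
              p ⊕ q ∝[ m ] case (⊤ᶜ ∶ P □ ⊤ᶜ ∶ Q □ [])
  choice    : ∀ {φ p q P bs} → Guarded P → p ∝⟨ φ ⟩ P → q ∝[ loose ] case bs →
              p ⊕ q ∝[ loose ] case (φ ∶ P □ bs)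
  ν         : ∀ {m x p P} → p ∝[ m ] P → ν x p ∝[ m ] ν x P
  _∣_       : ∀ {m p q P Q} → p ∝[ m ] P → q ∝[ m ] Q → p ∣ q ∝[ m ] P ∣ Q
  rep       : ∀ {m p P} → Guarded P → p ∝[ m ] P → ! p ∝[ m ] ! P

-- A branch with a false condition is represented by any dead agent with the free names of the
-- branch. Representation by 0 would lose these names, and with them side conditions on freshness.
data _∝⟨_⟩_ where
  true  : ∀ {p P} → p ∝[ loose ] P → p ∝⟨ ⊤ᶜ ⟩ P
  equal : ∀ {a b p P} → p ∝[ loose ] P → match a b p ∝⟨ a ≈ b ⟩ P
  false : ∀ {p q P} → Dead p → fn p ≐ fn q → q ∝[ loose ] P → p ∝⟨ ⊥ᶜ ⟩ P

private
  variable
    m : Mode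
    φ : Condition

∝-wellFormed : p ∝[ m ] P → WellFormed P
∝⟨⟩-wellFormed : p ∝⟨ φ ⟩ P → WellFormed P

∝-wellFormed 𝟎             = case [] []
∝-wellFormed assertion     = assertion
∝-wellFormed (input (binders u v e _) s) = input v u e (∝-wellFormed s)
∝-wellFormed (output s)    = output (∝-wellFormed s)
∝-wellFormed (match g s)   = case (g ∷ []) (∝-wellFormed s ∷ [])
∝-wellFormed (sum g h s t) = case (g ∷ h ∷ []) (∝-wellFormed s ∷ ∝-wellFormed t ∷ [])
∝-wellFormed (choice g s t) with case gs ws ← ∝-wellFormed t =
  case (g ∷ gs) (∝⟨⟩-wellFormed s ∷ ws)
∝-wellFormed (ν s)         = ν (∝-wellFormed s)
∝-wellFormed (s ∣ t)       = ∝-wellFormed s ∣ ∝-wellFormed t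
∝-wellFormed (rep g s)     = rep g (∝-wellFormed s)

∝⟨⟩-wellFormed (true s)      = ∝-wellFormed s
∝⟨⟩-wellFormed (equal s)     = ∝-wellFormed s
∝⟨⟩-wellFormed (false _ _ s) = ∝-wellFormed s

-- Representation preserves free names

∝-names⁺ : p ∝[ m ] P → fn p ⊆ names P
∝-names⁻ : p ∝[ m ] P → names P ⊆ fn p
∝⟨⟩-names⁺ : p ∝⟨ φ ⟩ P → fn p ⊆ names φ ++ names P
∝⟨⟩-names⁻ : p ∝⟨ φ ⟩ P → names φ ++ names P ⊆ fn p

∝-names⁺ (input B s) (here eq) = here eq
∝-names⁺ (input {ys = ys} {p = p} B s) (there q) with ∈-∖⁻ (fn p) q
... | z∈ , z∉ = there (∈-∖⁺ (∈-++⁺ʳ ys (∝-names⁺ s z∈)) λ r → z∉ (Equivalence.to (same-names B) r))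
∝-names⁺ (output s) (here eq) = here eq
∝-names⁺ (output {ys = ys} s) (there q) with ∈-++⁻ ys q
... | inj₁ r = there (∈-++⁺ˡ r)
... | inj₂ r = there (∈-++⁺ʳ ys (∝-names⁺ s r))
∝-names⁺ (match g s) (here eq)         = here eq
∝-names⁺ (match g s) (there (here eq)) = there (here eq)
∝-names⁺ (match g s) (there (there q)) = there (there (∈-++⁺ˡ (∝-names⁺ s q)))
∝-names⁺ (sum {p = p} {P = P} g h s t) q with ∈-++⁻ (fn p) q
... | inj₁ r = ∈-++⁺ˡ (∝-names⁺ s r)
... | inj₂ r = ∈-++⁺ʳ (names P) (∈-++⁺ˡ (∝-names⁺ t r))
∝-names⁺ (choice {φ} {p} {P = P} g s t) q with ∈-++⁻ (fn p) q
... | inj₂ r = ∈-++⁺ʳ (names φ) (∈-++⁺ʳ (names P) (∝-names⁺ t r))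
... | inj₁ r with ∈-++⁻ (names φ) (∝⟨⟩-names⁺ s r)
...   | inj₁ z∈ = ∈-++⁺ˡ z∈
...   | inj₂ z∈ = ∈-++⁺ʳ (names φ) (∈-++⁺ˡ z∈)
∝-names⁺ (ν {p = p} s) q with ∈-∖⁻ (fn p) q
... | z∈ , z∉ = ∈-∖⁺ (∝-names⁺ s z∈) z∉
∝-names⁺ (_∣_ {p = p} {P = P} s t) q with ∈-++⁻ (fn p) q
... | inj₁ r = ∈-++⁺ˡ (∝-names⁺ s r)
... | inj₂ r = ∈-++⁺ʳ (names P) (∝-names⁺ t r)
∝-names⁺ (rep g s) q = ∝-names⁺ s q

∝-names⁻ (input B s) (here eq) = here eq
∝-names⁻ (input {ys = ys} {P = P} B s) (there q) with ∈-∖⁻ (ys ++ names P) q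
... | z∈ , z∉ with ∈-++⁻ ys z∈
...   | inj₁ z∈ys = ⊥-elim (z∉ (Equivalence.from (same-names B) z∈ys))
...   | inj₂ z∈P  = there (∈-∖⁺ (∝-names⁻ s z∈P) λ r → z∉ (Equivalence.from (same-names B) r))
∝-names⁻ (output s) (here eq) = here eq
∝-names⁻ (output {ys = ys} s) (there q) with ∈-++⁻ ys q
... | inj₁ r = there (∈-++⁺ˡ r)
... | inj₂ r = there (∈-++⁺ʳ ys (∝-names⁻ s r))
∝-names⁻ (match g s) (here eq)         = here eq
∝-names⁻ (match g s) (there (here eq)) = there (here eq)
∝-names⁻ (match {P = P} g s) (there (there q)) with ∈-++⁻ (names P) q
... | inj₁ r = there (there (∝-names⁻ s r))
∝-names⁻ (sum {p = p} {P = P} {Q} g h s t) q with ∈-++⁻ (names P) q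
... | inj₁ r = ∈-++⁺ˡ (∝-names⁻ s r)
... | inj₂ r with ∈-++⁻ (names Q) r
...   | inj₁ r = ∈-++⁺ʳ (fn p) (∝-names⁻ t r)
∝-names⁻ (choice {φ} {p} {P = P} g s t) q with ∈-++⁻ (names φ) q
... | inj₁ r = ∈-++⁺ˡ (∝⟨⟩-names⁻ s (∈-++⁺ˡ r))
... | inj₂ r with ∈-++⁻ (names P) r
...   | inj₁ r = ∈-++⁺ˡ (∝⟨⟩-names⁻ s (∈-++⁺ʳ (names φ) r))
...   | inj₂ r = ∈-++⁺ʳ (fn p) (∝-names⁻ t r)
∝-names⁻ (ν {P = P} s) q with ∈-∖⁻ (names P) q
... | z∈ , z∉ = ∈-∖⁺ (∝-names⁻ s z∈) z∉
∝-names⁻ (_∣_ {p = p} {P = P} s t) q with ∈-++⁻ (names P) q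
... | inj₁ r = ∈-++⁺ˡ (∝-names⁻ s r)
... | inj₂ r = ∈-++⁺ʳ (fn p) (∝-names⁻ t r)
∝-names⁻ (rep g s) q = ∝-names⁻ s q

∝⟨⟩-names⁺ (true s) q = ∝-names⁺ s q
∝⟨⟩-names⁺ (equal s) (here eq)         = here eq
∝⟨⟩-names⁺ (equal s) (there (here eq)) = there (here eq)
∝⟨⟩-names⁺ (equal s) (there (there q)) = there (there (∝-names⁺ s q))
∝⟨⟩-names⁺ (false D e s) q = ∝-names⁺ s (Equivalence.to e q)

∝⟨⟩-names⁻ (true s) q = ∝-names⁻ s q
∝⟨⟩-names⁻ (equal s) (here eq)         = here eq
∝⟨⟩-names⁻ (equal s) (there (here eq)) = there (here eq)
∝⟨⟩-names⁻ (equal s) (there (there q)) = there (there (∝-names⁻ s q))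
∝⟨⟩-names⁻ (false D e s) q = Equivalence.from e (∝-names⁻ s q)

-- Representation is equivariant

Binders-swap : ∀ a b {xs ys} → Binders m xs ys →
               Binders m (map (swapName a b) xs) (map (swapName a b) ys)
Binders-swap a b (binders u v e o) =
  binders (swap-Unique a b u) (swap-Unique a b v) (map-≐ (swapName a b) e)
          (cong (map (swapName a b)) ∘ o)

Binders-unswap : ∀ a b {xs ys} → Binders m (map (swapName a b) xs) (map (swapName a b) ys) →
                 Binders m xs ys
Binders-unswap {m} a b {xs} {ys} B =
  subst (λ us → Binders m us ys) (map-swap-involutive a b xs)
    (subst (Binders m _) (map-swap-involutive a b ys) (Binders-swap a b B))

OutputAt-swap : ∀ a b {x} → OutputAt x p → OutputAt (swapName a b x) (swap a b p)
OutputAt-swap a b at = at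

Dead-swap : ∀ a b → Dead p → Dead (swap a b p)
Dead-swap a b (dead o) = dead (OutputAt-swap a b o)

≐-swap : ∀ a b p q → fn p ≐ fn q → fn (swap a b p) ≐ fn (swap a b q)
≐-swap a b p q e = mk⇔ (go p q (Equivalence.to e)) (go q p (Equivalence.from e))
  where
  go : ∀ p q → fn p ⊆ fn q → fn (swap a b p) ⊆ fn (swap a b q)
  go p q p⊆q {z} z∈ = subst (_∈ fn (swap a b q)) (swapName-involutive a b z)
                            (fn-swap⁺ a b q (p⊆q (fn-swap⁻ a b p z∈)))

∝-swap : ∀ a b → p ∝[ m ] P → swap a b p ∝[ m ] swap a b P
∝⟨⟩-swap : ∀ a b → p ∝⟨ φ ⟩ P → swap a b p ∝⟨ swap a b φ ⟩ swap a b P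

∝-swap a b 𝟎             = 𝟎
∝-swap a b assertion     = assertion
∝-swap a b (input B s)   = input (Binders-swap a b B) (∝-swap a b s)
∝-swap a b (output s)    = output (∝-swap a b s)
∝-swap a b (match g s)   = match (Guarded-swap a b g) (∝-swap a b s)
∝-swap a b (sum g h s t) =
  sum (Guarded-swap a b g) (Guarded-swap a b h) (∝-swap a b s) (∝-swap a b t)
∝-swap a b (choice g s t) = choice (Guarded-swap a b g) (∝⟨⟩-swap a b s) (∝-swap a b t)
∝-swap a b (ν s)         = ν (∝-swap a b s)
∝-swap a b (s ∣ t)       = ∝-swap a b s ∣ ∝-swap a b t
∝-swap a b (rep g s)     = rep (Guarded-swap a b g) (∝-swap a b s)

∝⟨⟩-swap a b (true s)     = true (∝-swap a b s)
∝⟨⟩-swap a b (equal s)     = equal (∝-swap a b s)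
∝⟨⟩-swap a b (false {p} {q} D e s) = false (Dead-swap a b D) (≐-swap a b p q e) (∝-swap a b s)

∝-unswapˡ : ∀ a b → swap a b p ∝[ m ] P → p ∝[ m ] swap a b P
∝-unswapˡ {p} {m} {P} a b s =
  subst (_∝[ m ] swap a b P) (swap-involutive a b p) (∝-swap a b s)

∝-unswapʳ : ∀ a b → p ∝[ m ] swap a b P → swap a b p ∝[ m ] P
∝-unswapʳ {p} {m} {P} a b s =
  subst (swap a b p ∝[ m ]_) (swapψ-involutive a b P) (∝-swap a b s)

-- Representation commutes with alpha-equivalence

OutputAt-α⁺ : ∀ {x} → p =π q → OutputAt x p → OutputAt x q
OutputAt-α⁻ : ∀ {x} → p =π q → OutputAt x q → OutputAt x p

OutputAt-α⁺ refl        o  = o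
OutputAt-α⁺ (sym d)     o  = OutputAt-α⁻ d o
OutputAt-α⁺ (trans d e) o  = OutputAt-α⁺ e (OutputAt-α⁺ d o)
OutputAt-α⁺ (output d)  at = at

OutputAt-α⁻ refl        o  = o
OutputAt-α⁻ (sym d)     o  = OutputAt-α⁺ d o
OutputAt-α⁻ (trans d e) o  = OutputAt-α⁻ d (OutputAt-α⁻ e o)
OutputAt-α⁻ (output d)  at = at

Dead-α⁺ : p =π q → Dead p → Dead q
Dead-α⁻ : p =π q → Dead q → Dead p

Dead-α⁺ refl        D = D
Dead-α⁺ (sym d)     D = Dead-α⁻ d D
Dead-α⁺ (trans d e) D = Dead-α⁺ e (Dead-α⁺ d D)
Dead-α⁺ (rename-ν {a} {b} {p} _) (dead o) =
  dead (subst (λ x → OutputAt x (swap a b p)) (swapName-left a b) (OutputAt-swap a b o))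
Dead-α⁺ (ν d) (dead o) = dead (OutputAt-α⁺ d o)

Dead-α⁻ refl        D = D
Dead-α⁻ (sym d)     D = Dead-α⁺ d D
Dead-α⁻ (trans d e) D = Dead-α⁻ d (Dead-α⁻ e D)
Dead-α⁻ (rename-ν {a} {b} {p} _) (dead o) =
  dead (subst (λ x → OutputAt x p) (swapName-right a b)
    (subst (OutputAt (swapName a b b)) (swap-involutive a b p) (OutputAt-swap a b o)))
Dead-α⁻ (ν d) (dead o) = dead (OutputAt-α⁻ d o)

fn-α : p =π q → fn p ≐ fn q
fn-α d = mk⇔ (fn-α⁺ d) (fn-α⁻ d)

-- Alpha-converting the representing agent can be followed by alpha-converting the represented
-- one. The two lemmas for the two directions of a derivation of alpha-equivalence are mutual
-- because of the constructor sym.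
∝-αˡ⁺ : p =π q → p ∝[ m ] P → ∃[ Q ] P =ψ Q × q ∝[ m ] Q
∝-αˡ⁻ : p =π q → q ∝[ m ] Q → ∃[ P ] Q =ψ P × p ∝[ m ] P
∝⟨⟩-αˡ⁺ : p =π q → p ∝⟨ φ ⟩ P → ∃[ Q ] P =ψ Q × q ∝⟨ φ ⟩ Q
∝⟨⟩-αˡ⁻ : p =π q → q ∝⟨ φ ⟩ Q → ∃[ P ] Q =ψ P × p ∝⟨ φ ⟩ P

∝-αˡ⁺ refl    s = _ , refl , s
∝-αˡ⁺ (sym d) s = ∝-αˡ⁻ d s
∝-αˡ⁺ (trans d e) s with _ , d′ , s′ ← ∝-αˡ⁺ d s with _ , e′ , s″ ← ∝-αˡ⁺ e s′ =
  _ , trans d′ e′ , s″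
∝-αˡ⁺ (rename-ν b#p) (ν s) = _ , rename-ν (b#p ∘ ∝-names⁻ s) , ν (∝-swap _ _ s)
∝-αˡ⁺ (rename-input a∈ b# b#p) (input B s) =
  _ , rename-input (Equivalence.from (same-names B) a∈) (b# ∘ Equivalence.to (same-names B)) b#
        (b#p ∘ ∝-names⁻ s)
    , input (Binders-swap _ _ B) (∝-swap _ _ s)
∝-αˡ⁺ (input d) (input B s) with _ , e , s′ ← ∝-αˡ⁺ d s = _ , input e , input B s′
∝-αˡ⁺ (output d) (output s) with _ , e , s′ ← ∝-αˡ⁺ d s = _ , output e , output s′
∝-αˡ⁺ (match d) (match g s) with _ , e , s′ ← ∝-αˡ⁺ d s =
  _ , case (e ∷ []) , match (Guarded-α⁺ e g) s′
∝-αˡ⁺ (ν d) (ν s) with _ , e , s′ ← ∝-αˡ⁺ d s = _ , ν e , ν s′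
∝-αˡ⁺ (! d) (rep g s) with _ , e , s′ ← ∝-αˡ⁺ d s = _ , ! e , rep (Guarded-α⁺ e g) s′
∝-αˡ⁺ (d₁ ∣ d₂) (s ∣ t) with _ , e₁ , s′ ← ∝-αˡ⁺ d₁ s with _ , e₂ , t′ ← ∝-αˡ⁺ d₂ t =
  _ , e₁ ∣ e₂ , s′ ∣ t′
∝-αˡ⁺ (d₁ ⊕ d₂) (sum g h s t)
  with _ , e₁ , s′ ← ∝-αˡ⁺ d₁ s with _ , e₂ , t′ ← ∝-αˡ⁺ d₂ t =
  _ , case (e₁ ∷ e₂ ∷ []) , sum (Guarded-α⁺ e₁ g) (Guarded-α⁺ e₂ h) s′ t′
∝-αˡ⁺ (d₁ ⊕ d₂) (choice g s t)
  with _ , e₁ , s′ ← ∝⟨⟩-αˡ⁺ d₁ s with _ , e₂ , t′ ← ∝-αˡ⁺ d₂ t with _ , refl , es ← case-α⁺ e₂ =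
  _ , case (e₁ ∷ es) , choice (Guarded-α⁺ e₁ g) s′ t′

∝-αˡ⁻ refl    s = _ , refl , s
∝-αˡ⁻ (sym d) s = ∝-αˡ⁺ d s
∝-αˡ⁻ (trans d e) s with _ , e′ , s′ ← ∝-αˡ⁻ e s with _ , d′ , s″ ← ∝-αˡ⁻ d s′ =
  _ , trans e′ d′ , s″
∝-αˡ⁻ {Q = ν _ Q} (rename-ν {a} {b} b#p) (ν s) =
  _ , sym (subst (λ R → ν a (swap a b Q) =ψ ν b R) (swapψ-involutive a b Q)
            (rename-ν (b#p ∘ ∝-names⁻ (∝-unswapˡ a b s))))
    , ν (∝-unswapˡ a b s)
∝-αˡ⁻ {Q = input M xs _ Q}
      (rename-input {a} {b} {x} {ys} {p} a∈ b# b#p) (input B s) =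
  _ , sym (subst (λ us → input M (map (swapName a b) xs) ⟨ ys ⟩ (swap a b Q) =ψ
                         input M us ⟨ map (swapName a b) ys ⟩ Q)
                 (map-swap-involutive a b xs)
            (subst (λ R → input M (map (swapName a b) xs) ⟨ ys ⟩ (swap a b Q) =ψ
                          input M _ ⟨ map (swapName a b) ys ⟩ R) (swapψ-involutive a b Q)
              (rename-input (Equivalence.from (same-names B′) a∈)
                (b# ∘ Equivalence.to (same-names B′)) b# (b#p ∘ ∝-names⁻ s′))))
    , input B′ s′
  where
  B′ = Binders-unswap a b (subst (λ us → Binders _ us _) (≡-sym (map-swap-involutive a b xs)) B)
  s′ = ∝-unswapˡ a b s
∝-αˡ⁻ (input d) (input B s) with _ , e , s′ ← ∝-αˡ⁻ d s = _ , input e , input B s′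
∝-αˡ⁻ (output d) (output s) with _ , e , s′ ← ∝-αˡ⁻ d s = _ , output e , output s′
∝-αˡ⁻ (match d) (match g s) with _ , e , s′ ← ∝-αˡ⁻ d s =
  _ , case (e ∷ []) , match (Guarded-α⁺ e g) s′
∝-αˡ⁻ (ν d) (ν s) with _ , e , s′ ← ∝-αˡ⁻ d s = _ , ν e , ν s′
∝-αˡ⁻ (! d) (rep g s) with _ , e , s′ ← ∝-αˡ⁻ d s = _ , ! e , rep (Guarded-α⁺ e g) s′
∝-αˡ⁻ (d₁ ∣ d₂) (s ∣ t) with _ , e₁ , s′ ← ∝-αˡ⁻ d₁ s with _ , e₂ , t′ ← ∝-αˡ⁻ d₂ t =
  _ , e₁ ∣ e₂ , s′ ∣ t′
∝-αˡ⁻ (d₁ ⊕ d₂) (sum g h s t)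
  with _ , e₁ , s′ ← ∝-αˡ⁻ d₁ s with _ , e₂ , t′ ← ∝-αˡ⁻ d₂ t =
  _ , case (e₁ ∷ e₂ ∷ []) , sum (Guarded-α⁺ e₁ g) (Guarded-α⁺ e₂ h) s′ t′
∝-αˡ⁻ (d₁ ⊕ d₂) (choice g s t)
  with _ , e₁ , s′ ← ∝⟨⟩-αˡ⁻ d₁ s with _ , e₂ , t′ ← ∝-αˡ⁻ d₂ t with _ , refl , es ← case-α⁺ e₂ =
  _ , case (e₁ ∷ es) , choice (Guarded-α⁺ e₁ g) s′ t′

∝⟨⟩-αˡ⁺ refl    s = _ , refl , s
∝⟨⟩-αˡ⁺ (sym d) s = ∝⟨⟩-αˡ⁻ d s
∝⟨⟩-αˡ⁺ (trans d e) s with _ , d′ , s′ ← ∝⟨⟩-αˡ⁺ d s with _ , e′ , s″ ← ∝⟨⟩-αˡ⁺ e s′ =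
  _ , trans d′ e′ , s″
∝⟨⟩-αˡ⁺ d (true s) with _ , e , s′ ← ∝-αˡ⁺ d s = _ , e , true s′
∝⟨⟩-αˡ⁺ d (false D e s) = _ , refl , false (Dead-α⁺ d D) (≐-trans (fn-α (sym d)) e) s
∝⟨⟩-αˡ⁺ (match d) (equal s) with _ , e , s′ ← ∝-αˡ⁺ d s = _ , e , equal s′

∝⟨⟩-αˡ⁻ refl    s = _ , refl , s
∝⟨⟩-αˡ⁻ (sym d) s = ∝⟨⟩-αˡ⁺ d s
∝⟨⟩-αˡ⁻ (trans d e) s with _ , e′ , s′ ← ∝⟨⟩-αˡ⁻ e s with _ , d′ , s″ ← ∝⟨⟩-αˡ⁻ d s′ =
  _ , trans e′ d′ , s″
∝⟨⟩-αˡ⁻ d (true s) with _ , e , s′ ← ∝-αˡ⁻ d s = _ , e , true s′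
∝⟨⟩-αˡ⁻ d (false D e s) = _ , refl , false (Dead-α⁻ d D) (≐-trans (fn-α d) e) s
∝⟨⟩-αˡ⁻ (match d) (equal s) with _ , e , s′ ← ∝-αˡ⁻ d s = _ , e , equal s′

-- The same with the roles of the two agents exchanged.
∝-αʳ⁺ : P =ψ Q → p ∝[ m ] P → ∃[ q ] p =π q × q ∝[ m ] Q
∝-αʳ⁻ : P =ψ Q → q ∝[ m ] Q → ∃[ p ] q =π p × p ∝[ m ] P
∝ᵇ-αʳ⁺ : bs₁ =ψᵇ bs₂ → p ∝[ m ] case bs₁ → ∃[ q ] p =π q × q ∝[ m ] case bs₂
∝ᵇ-αʳ⁻ : bs₁ =ψᵇ bs₂ → q ∝[ m ] case bs₂ → ∃[ p ] q =π p × p ∝[ m ] case bs₁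
∝⟨⟩-αʳ⁺ : P =ψ Q → p ∝⟨ φ ⟩ P → ∃[ q ] p =π q × q ∝⟨ φ ⟩ Q
∝⟨⟩-αʳ⁻ : P =ψ Q → q ∝⟨ φ ⟩ Q → ∃[ p ] q =π p × p ∝⟨ φ ⟩ P

∝-αʳ⁺ refl    s = _ , refl , s
∝-αʳ⁺ (sym d) s = ∝-αʳ⁻ d s
∝-αʳ⁺ (trans d e) s with _ , d′ , s′ ← ∝-αʳ⁺ d s with _ , e′ , s″ ← ∝-αʳ⁺ e s′ =
  _ , trans d′ e′ , s″
∝-αʳ⁺ (rename-ν b#P) (ν s) = _ , rename-ν (b#P ∘ ∝-names⁺ s) , ν (∝-swap _ _ s)
∝-αʳ⁺ (rename-input a∈ b# b#X b#P) (input B s) =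
  _ , rename-input (Equivalence.to (same-names B) a∈) b#X (b#P ∘ ∝-names⁺ s)
    , input (Binders-swap _ _ B) (∝-swap _ _ s)
∝-αʳ⁺ (input d) (input B s) with _ , e , s′ ← ∝-αʳ⁺ d s = _ , input e , input B s′
∝-αʳ⁺ (output d) (output s) with _ , e , s′ ← ∝-αʳ⁺ d s = _ , output e , output s′
∝-αʳ⁺ (case ds) s = ∝ᵇ-αʳ⁺ ds s
∝-αʳ⁺ (ν d) (ν s) with _ , e , s′ ← ∝-αʳ⁺ d s = _ , ν e , ν s′
∝-αʳ⁺ (! d) (rep g s) with _ , e , s′ ← ∝-αʳ⁺ d s = _ , ! e , rep (Guarded-α⁺ d g) s′
∝-αʳ⁺ (d₁ ∣ d₂) (s ∣ t) with _ , e₁ , s′ ← ∝-αʳ⁺ d₁ s with _ , e₂ , t′ ← ∝-αʳ⁺ d₂ t =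
  _ , e₁ ∣ e₂ , s′ ∣ t′

∝-αʳ⁻ refl    s = _ , refl , s
∝-αʳ⁻ (sym d) s = ∝-αʳ⁺ d s
∝-αʳ⁻ (trans d e) s with _ , e′ , s′ ← ∝-αʳ⁻ e s with _ , d′ , s″ ← ∝-αʳ⁻ d s′ =
  _ , trans e′ d′ , s″
∝-αʳ⁻ {q = ν _ q} (rename-ν {a} {b} b#P) (ν s) =
  _ , sym (subst (λ r → ν a (swap a b q) =π ν b r) (swap-involutive a b q)
            (rename-ν (b#P ∘ ∝-names⁺ (∝-unswapʳ a b s))))
    , ν (∝-unswapʳ a b s)
∝-αʳ⁻ {q = input x _ q}
      (rename-input {a} {b} {X = ⟨ ys ⟩} a∈ b# b#X b#P) (input B s) =
  _ , sym (subst (λ r → input x ys (swap a b q) =π input x (map (swapName a b) ys) r)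
                 (swap-involutive a b q)
            (rename-input (Equivalence.to (same-names B′) a∈) b#X (b#P ∘ ∝-names⁺ s′)))
    , input B′ s′
  where
  B′ = Binders-unswap a b B
  s′ = ∝-unswapʳ a b s
∝-αʳ⁻ (input d) (input B s) with _ , e , s′ ← ∝-αʳ⁻ d s = _ , input e , input B s′
∝-αʳ⁻ (output d) (output s) with _ , e , s′ ← ∝-αʳ⁻ d s = _ , output e , output s′
∝-αʳ⁻ (case ds) s = ∝ᵇ-αʳ⁻ ds s
∝-αʳ⁻ (ν d) (ν s) with _ , e , s′ ← ∝-αʳ⁻ d s = _ , ν e , ν s′
∝-αʳ⁻ (! d) (rep g s) with _ , e , s′ ← ∝-αʳ⁻ d s = _ , ! e , rep (Guarded-α⁻ d g) s′
∝-αʳ⁻ (d₁ ∣ d₂) (s ∣ t) with _ , e₁ , s′ ← ∝-αʳ⁻ d₁ s with _ , e₂ , t′ ← ∝-αʳ⁻ d₂ t =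
  _ , e₁ ∣ e₂ , s′ ∣ t′

∝ᵇ-αʳ⁺ [] 𝟎 = _ , refl , 𝟎
∝ᵇ-αʳ⁺ (d ∷ []) (match g s) with _ , e , s′ ← ∝-αʳ⁺ d s = _ , match e , match (Guarded-α⁺ d g) s′
∝ᵇ-αʳ⁺ (d₁ ∷ d₂ ∷ []) (sum g h s t)
  with _ , e₁ , s′ ← ∝-αʳ⁺ d₁ s with _ , e₂ , t′ ← ∝-αʳ⁺ d₂ t =
  _ , e₁ ⊕ e₂ , sum (Guarded-α⁺ d₁ g) (Guarded-α⁺ d₂ h) s′ t′
∝ᵇ-αʳ⁺ (d ∷ ds) (choice g s t)
  with _ , e₁ , s′ ← ∝⟨⟩-αʳ⁺ d s with _ , e₂ , t′ ← ∝ᵇ-αʳ⁺ ds t =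
  _ , e₁ ⊕ e₂ , choice (Guarded-α⁺ d g) s′ t′

∝ᵇ-αʳ⁻ [] 𝟎 = _ , refl , 𝟎
∝ᵇ-αʳ⁻ (d ∷ []) (match g s) with _ , e , s′ ← ∝-αʳ⁻ d s = _ , match e , match (Guarded-α⁻ d g) s′
∝ᵇ-αʳ⁻ (d₁ ∷ d₂ ∷ []) (sum g h s t)
  with _ , e₁ , s′ ← ∝-αʳ⁻ d₁ s with _ , e₂ , t′ ← ∝-αʳ⁻ d₂ t =
  _ , e₁ ⊕ e₂ , sum (Guarded-α⁻ d₁ g) (Guarded-α⁻ d₂ h) s′ t′
∝ᵇ-αʳ⁻ (d ∷ ds) (choice g s t)
  with _ , e₁ , s′ ← ∝⟨⟩-αʳ⁻ d s with _ , e₂ , t′ ← ∝ᵇ-αʳ⁻ ds t =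
  _ , e₁ ⊕ e₂ , choice (Guarded-α⁻ d g) s′ t′

∝⟨⟩-αʳ⁺ d (true s) with _ , e , s′ ← ∝-αʳ⁺ d s = _ , e , true s′
∝⟨⟩-αʳ⁺ d (equal s) with _ , e , s′ ← ∝-αʳ⁺ d s = _ , match e , equal s′
∝⟨⟩-αʳ⁺ d (false D e s) with _ , f , s′ ← ∝-αʳ⁺ d s = _ , refl , false D (≐-trans e (fn-α f)) s′

∝⟨⟩-αʳ⁻ d (true s) with _ , e , s′ ← ∝-αʳ⁻ d s = _ , e , true s′
∝⟨⟩-αʳ⁻ d (equal s) with _ , e , s′ ← ∝-αʳ⁻ d s = _ , match e , equal s′
∝⟨⟩-αʳ⁻ d (false D e s) with _ , f , s′ ← ∝-αʳ⁻ d s = _ , refl , false D (≐-trans e (fn-α f)) s′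

-- The encoding, and totality of representation

-- The homomorphic encoding of the polyadic pi-calculus.
encode : Agentπ → Agentψ
encode 𝟎               = case []
encode (input x ys p)  = input (name x) ys ⟨ ys ⟩ (encode p)
encode (output x ys p) = output (name x) (tuple ys) (encode p)
encode (match a b p)   = case (a ≈ b ∶ encode p □ [])
encode (ν x p)         = ν x (encode p)
encode (! p)           = ! encode p
encode (p ∣ q)         = encode p ∣ encode q
encode (p ⊕ q)         = case (⊤ᶜ ∶ encode p □ ⊤ᶜ ∶ encode q □ [])

encode-Guarded : ∀ p → Guarded (encode p)
encode-Guarded 𝟎               = case []
encode-Guarded (input x ys p)  = input
encode-Guarded (output x ys p) = output
encode-Guarded (match a b p)   = case (encode-Guarded p ∷ [])
encode-Guarded (ν x p)         = ν (encode-Guarded p)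
encode-Guarded (! p)           = ! encode-Guarded p
encode-Guarded (p ∣ q)         = encode-Guarded p ∣ encode-Guarded q
encode-Guarded (p ⊕ q)         = case (encode-Guarded p ∷ encode-Guarded q ∷ [])

encode-∝ : PolyadicPi.WellFormed p → p ∝[ m ] encode p
encode-∝ 𝟎           = 𝟎
encode-∝ (input u w) = input (binders u u (mk⇔ id id) (λ _ → refl)) (encode-∝ w)
encode-∝ (output w)  = output (encode-∝ w)
encode-∝ (match w)   = match (encode-Guarded _) (encode-∝ w)
encode-∝ (ν w)       = ν (encode-∝ w)
encode-∝ (! w)       = rep (encode-Guarded _) (encode-∝ w)
encode-∝ (w ∣ v)     = encode-∝ w ∣ encode-∝ v
encode-∝ (w ⊕ v)     = sum (encode-Guarded _) (encode-Guarded _) (encode-∝ w) (encode-∝ v)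

exact-encode : p ∝[ exact ] P → P ≡ encode p
exact-encode 𝟎           = refl
exact-encode (input B s) =
  cong₂ (λ us P → input (name _) us ⟨ _ ⟩ P) (same-order B refl) (exact-encode s)
exact-encode (output s)  = cong (output _ _) (exact-encode s)
exact-encode (match g s) = cong (λ P → case (_ ≈ _ ∶ P □ [])) (exact-encode s)
exact-encode (sum g h s t) =
  cong₂ (λ P Q → case (⊤ᶜ ∶ P □ ⊤ᶜ ∶ Q □ [])) (exact-encode s) (exact-encode t)
exact-encode (ν s)       = cong (ν _) (exact-encode s)
exact-encode (s ∣ t)     = cong₂ _∣_ (exact-encode s) (exact-encode t)
exact-encode (rep g s)   = cong !_ (exact-encode s)

exact-wellFormed : p ∝[ exact ] P → PolyadicPi.WellFormed p
exact-wellFormed 𝟎             = 𝟎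
exact-wellFormed (input B s)   = input (unique-pattern B) (exact-wellFormed s)
exact-wellFormed (output s)    = output (exact-wellFormed s)
exact-wellFormed (match g s)   = match (exact-wellFormed s)
exact-wellFormed (sum g h s t) = exact-wellFormed s ⊕ exact-wellFormed t
exact-wellFormed (ν s)         = ν (exact-wellFormed s)
exact-wellFormed (s ∣ t)       = exact-wellFormed s ∣ exact-wellFormed t
exact-wellFormed (rep g s)     = ! exact-wellFormed s

-- Every well-formed psi-calculus agent represents some polyadic pi-calculus agent.

decode  : WellFormed P → ∃[ p ] PolyadicPi.WellFormed p × p ∝[ loose ] P
decodeᵇ : Guardedᵇ bs₁ → WellFormedᵇ bs₁ →
          ∃[ p ] PolyadicPi.WellFormed p × p ∝[ loose ] case bs₁
decode⟨⟩ : ∀ φ → WellFormed P → ∃[ p ] PolyadicPi.WellFormed p × p ∝⟨ φ ⟩ P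

decode (output w) with _ , v , s ← decode w = _ , output v , output s
decode (input u u′ e w) with _ , v , s ← decode w =
  _ , input u v , input (binders u′ u e λ ()) s
decode (case gs ws) = decodeᵇ gs ws
decode (ν w) with _ , v , s ← decode w = _ , ν v , ν s
decode (w₁ ∣ w₂) with _ , v₁ , s₁ ← decode w₁ with _ , v₂ , s₂ ← decode w₂ =
  _ , v₁ ∣ v₂ , s₁ ∣ s₂
decode (rep g w) with _ , v , s ← decode w = _ , ! v , rep g s
decode assertion = _ , 𝟎 , assertion

decodeᵇ [] [] = _ , 𝟎 , 𝟎
decodeᵇ (g ∷ gs) (w ∷ ws)
  with _ , v₁ , s₁ ← decode⟨⟩ _ w with _ , v₂ , s₂ ← decodeᵇ gs ws =
  _ , v₁ ⊕ v₂ , choice g s₁ s₂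

decode⟨⟩ ⊤ᶜ      w with _ , v , s ← decode w = _ , v , true s
decode⟨⟩ (a ≈ b) w with _ , v , s ← decode w = _ , match v , equal s
decode⟨⟩ ⊥ᶜ      w with p , v , s ← decode w =
  ν c (output c (fn p) 𝟎) , ν (output 𝟎) , false (dead at) (mk⇔ to from) s
  where
  -- The restricted subject must not capture a free name of the branch.
  c  = suc (foldr _⊔_ 0 (fn p))
  cs = c ∷ fn p ++ []

  to : ∀ {z} → z ∈ cs ∖ [ c ] → z ∈ fn p
  to q with ∈-∖⁻ {as = [ c ]} cs q
  ... | here refl , z∉ = ⊥-elim (z∉ (here refl))
  ... | there r   , z∉ with ∈-++⁻ (fn p) r
  ...   | inj₁ z∈ = z∈

  from : ∀ {z} → z ∈ fn p → z ∈ cs ∖ [ c ]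
  from z∈ = ∈-∖⁺ {xs = cs} {as = [ c ]} (there (∈-++⁺ˡ z∈))
                 (∉-single λ { refl → suc-max-∉ (fn p) z∈ })

-- Substitution of represented agents

≐-substitute : ∀ σ p q → fn p ≐ fn q → fn (substituteπ σ p) ≐ fn (substituteπ σ q)
≐-substitute σ p q e = mk⇔ (go p q (Equivalence.to e)) (go q p (Equivalence.from e))
  where
  go : ∀ p q → fn p ⊆ fn q → fn (substituteπ σ p) ⊆ fn (substituteπ σ q)
  go p q p⊆q z∈ with fn-substitute⁻ σ p z∈
  ... | n , n∈ , refl = fn-substitute⁺ σ q (p⊆q n∈)

Dead-substitute : ∀ σ → Dead p → Dead (substituteπ σ p)
Dead-substitute σ (dead {x} (at {ys} {p})) =
  dead (subst (λ z → OutputAt z (substituteπ ρ (output x ys p)))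
              (≔-map σ [ x ] (λ _ → c) (here refl)) at)
  where
  c = suc (foldr _⊔_ 0 (map σ (fn (output x ys p))))
  ρ = σ [ [ x ] ≔ [ c ] ]

-- Representation is preserved by substitution, up to alpha-equivalence on the left because
-- substitution chooses different bound names in the two calculi.
∝-substitute : ∀ {σ ρ} → (∀ n → σ n ≡ ρ n) → p ∝[ m ] P →
               ∃[ q ] substituteπ σ p =π q × q ∝[ m ] substituteψ ρ P
∝⟨⟩-substitute : ∀ {σ ρ} → (∀ n → σ n ≡ ρ n) → p ∝⟨ φ ⟩ P →
                 ∃[ q ] substituteπ σ p =π q × q ∝⟨ PPI.mapCondition ρ φ ⟩ substituteψ ρ P

∝-substitute e 𝟎 = _ , refl , 𝟎
∝-substitute e assertion = _ , refl , assertion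
∝-substitute {m = m} {σ = σ} {ρ} e (input {x = x} {xs} {ys} {p} {P} B s) rewrite e x
  -- The bound names that substituteψ chooses, in the order of the pattern, replace those that
  -- substituteπ chooses.
  with q , d , s′ ← ∝-substitute
         {σ = σ [ ys ≔ map (ρ [ xs ≔ fresh (map ρ (ys ++ names P)) (length xs) ]) ys ]}
         (≔-reorder e (same-names B)
           (≡-sym (length-fresh (map ρ (ys ++ names P)) (length xs)))) s =
  _ , trans (substitute-input-choice ys p ys₁ ys₂
              (fresh-Unique (map σ (fn p)) _) (unique-pattern B′)
              (≡-sym (length-fresh (map σ (fn p)) _)) (≡-sym (length-map ρ′ ys))
              (λ n∈ _ → fresh-∉ (map σ (fn p)) _ (∈-map⁺ σ n∈)) avoids)
            (input d)
    , input B′ s′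
  where
  xs′ = fresh (map ρ (ys ++ names P)) (length xs)
  ρ′  = ρ [ xs ≔ xs′ ]
  ys₁ = fresh (map σ (fn p)) (length ys)
  ys₂ = map ρ′ ys

  len : length xs ≡ length xs′
  len = ≡-sym (length-fresh (map ρ (ys ++ names P)) (length xs))

  onto : map ρ′ xs ≡ xs′
  onto = map-≔ ρ (unique-vars B) len

  U : Unique (map ρ′ xs)
  U = subst Unique (≡-sym onto) (fresh-Unique (map ρ (ys ++ names P)) (length xs))

  B′ : Binders m xs′ ys₂
  B′ = subst (λ us → Binders m us ys₂) onto
    (binders U (Unique-map-⊆ ρ′ U (unique-pattern B) (Equivalence.from (same-names B)))
      (map-≐ ρ′ (same-names B)) (cong (map ρ′) ∘ same-order B))

  avoids : ∀ {n} → n ∈ fn p → n ∉ ys → σ n ∉ ys₂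
  avoids {n} n∈ n∉ r with ∈-map⁻ ρ′ r
  ... | y , y∈ , eq = fresh-∉ (map ρ (ys ++ names P)) (length xs)
    (subst (_∈ map ρ (ys ++ names P)) (≡-sym (e n)) (∈-map⁺ ρ (∈-++⁺ʳ ys (∝-names⁺ s n∈))))
    (subst (_∈ xs′) (≡-sym eq) (≔-∈ ρ xs xs′ len (Equivalence.from (same-names B) y∈)))
∝-substitute e (output {x = x} {ys} s) rewrite e x | map-cong e ys
  with _ , d , s′ ← ∝-substitute e s = _ , output d , output s′
∝-substitute e (match {a = a} {b} g s) rewrite e a | e b
  with _ , d , s′ ← ∝-substitute e s = _ , match d , match (PPI.substitute-Guarded _ g) s′
∝-substitute e (sum g h s t)
  with _ , d₁ , s′ ← ∝-substitute e s with _ , d₂ , t′ ← ∝-substitute e t =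
  _ , d₁ ⊕ d₂ , sum (PPI.substitute-Guarded _ g) (PPI.substitute-Guarded _ h) s′ t′
∝-substitute e (choice g s t)
  with _ , d₁ , s′ ← ∝⟨⟩-substitute e s with _ , d₂ , t′ ← ∝-substitute e t =
  _ , d₁ ⊕ d₂ , choice (PPI.substitute-Guarded _ g) s′ t′
∝-substitute {σ = σ} {ρ} e (ν {x = x} {p} {P} s)
  with _ , d , s′ ← ∝-substitute {σ = σ [ [ x ] ≔ [ suc (foldr _⊔_ 0 (map ρ (names P))) ] ]}
                      (λ n → ≔-cong σ ρ [ x ] [ _ ] refl λ _ → e n) s =
  _ , trans (substitute-ν-choice x p _ _
              (λ n∈ _ r → suc-max-∉ cs (subst (_∈ cs) r (∈-map⁺ σ n∈)))
              (λ n∈ _ r → suc-max-∉ ds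
                (subst (_∈ ds) (≡-trans (≡-sym (e _)) r) (∈-map⁺ ρ (∝-names⁺ s n∈)))))
            (ν d)
    , ν s′
  where
  cs = map σ (fn p)
  ds = map ρ (names P)
∝-substitute e (s ∣ t)
  with _ , d₁ , s′ ← ∝-substitute e s with _ , d₂ , t′ ← ∝-substitute e t =
  _ , d₁ ∣ d₂ , s′ ∣ t′
∝-substitute e (rep g s) with _ , d , s′ ← ∝-substitute e s =
  _ , ! d , rep (PPI.substitute-Guarded _ g) s′

∝⟨⟩-substitute e (true s) with _ , d , s′ ← ∝-substitute e s = _ , d , true s′
∝⟨⟩-substitute e (equal {a} {b} s) rewrite e a | e b
  with _ , d , s′ ← ∝-substitute e s = _ , match d , equal s′
∝⟨⟩-substitute {σ = σ} e (false {p} {q} D f s) with _ , d , s′ ← ∝-substitute e s =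
  _ , refl , false (Dead-substitute σ D) (≐-trans (≐-substitute σ p q f) (fn-α d)) s′

-- Transitions of represented agents

infix 4 _≙_

-- The psi-calculus action with the same subject, object and bound names in the same order.
data _≙_ : Actionπ → Actionψ → Set where
  output : ∀ {as z ys} → output as z ys ≙ output (name z) as (tuple ys)
  input  : ∀ {x zs} → input x zs ≙ input (name x) (tuple zs)
  τ      : τ ≙ τ

private
  variable
    α : Actionψ
    β : Actionπ

bn-#⁺ : β ≙ α → p ∝[ m ] P → PolyadicPi.bn β #* p → PPI.bn α #* P
bn-#⁺ output s as# = All.map (_∘ ∝-names⁻ s) as#
bn-#⁺ input  s _   = []
bn-#⁺ τ      s _   = []

bn-#⁻ : β ≙ α → p ∝[ m ] P → PPI.bn α #* P → PolyadicPi.bn β #* p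
bn-#⁻ output s as# = All.map (_∘ ∝-names⁺ s) as#
bn-#⁻ input  s _   = []
bn-#⁻ τ      s _   = []

≙-names⁺ : β ≙ α → names β ⊆ names α
≙-names⁺ (output {as}) q with ∈-++⁻ as q
... | inj₁ r           = there (∈-++⁺ˡ r)
... | inj₂ (here eq)   = here eq
... | inj₂ (there r)   = there (∈-++⁺ʳ as r)
≙-names⁺ input q = q

≙-names⁻ : β ≙ α → names α ⊆ names β
≙-names⁻ (output {as}) (here eq) = ∈-++⁺ʳ as (here eq)
≙-names⁻ (output {as}) (there q) with ∈-++⁻ as q
... | inj₁ r = ∈-++⁺ˡ r
... | inj₂ r = ∈-++⁺ʳ as (there r)
≙-names⁻ input q = q

OutputAt-transition : ∀ {x} → OutputAt x p → p —π[ β ]→ p′ → ∃[ ys ] β ≡ output [] x ys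
OutputAt-transition o (agents-α d t e) = OutputAt-transition (OutputAt-α⁺ d o) t
OutputAt-transition o (actions-≈ t r) with OutputAt-transition o t
OutputAt-transition o (actions-≈ t (output r)) | _ , refl with refl ← ↭-empty-inv (↭-sym r) =
  _ , refl
OutputAt-transition o (bound-α t a∈ _ _ _) with OutputAt-transition o t
OutputAt-transition o (bound-α t () _ _ _) | _ , refl
OutputAt-transition at Out = _ , refl

Dead-transition : Dead p → p —π[ β ]→ p′ → ⊥
Dead-transition D (agents-α d t e)    = Dead-transition (Dead-α⁺ d D) t
Dead-transition D (actions-≈ t _)     = Dead-transition D t
Dead-transition D (bound-α t _ _ _ _) = Dead-transition D t
Dead-transition (dead o) (Res t x#β) with _ , refl ← OutputAt-transition o t = x#β (here refl)
Dead-transition (dead o) (Open t x≢z _ _) with _ , refl ← OutputAt-transition o t = x≢z refl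

∝-ν* : ∀ as → p ∝[ m ] P → ν*π as p ∝[ m ] ν*ψ as P
∝-ν* []       s = s
∝-ν* (a ∷ as) s = ν (∝-ν* as s)

-- A pi-calculus agent and a psi-calculus agent that it represents match each other's
-- transitions: forward from the pi-calculus, backward from the psi-calculus.
forward : p ∝[ m ] P → p —π[ β ]→ p′ → β ≙ α → ∃[ P′ ] P —ψ[ α ]→ P′ × p′ ∝[ m ] P′
forward⟨⟩ : Guarded P → p ∝⟨ φ ⟩ P → p —π[ β ]→ p′ → β ≙ α →
            𝟏 ⊢ φ × ∃[ P′ ] P —ψ[ α ]→ P′ × p′ ∝[ loose ] P′

forward s (agents-α d t e) l
  with _ , d′ , s₁ ← ∝-αˡ⁺ d s with _ , t′ , s₂ ← forward s₁ t l with _ , e′ , s₃ ← ∝-αˡ⁺ e s₂ =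
  _ , agents-α d′ t′ e′ , s₃
forward s (actions-≈ t (output r)) output with _ , t′ , s′ ← forward s t output =
  _ , reorder t′ r , s′
forward s (actions-≈ t input) l = forward s t l
forward s (actions-≈ t τ) l = forward s t l
forward s (bound-α t a∈ b≢z b#ys b#p) output with _ , t′ , s′ ← forward s t output =
  _ , bound-α t′ a∈ (∉-single b≢z) b#ys (b#p ∘ ∝-names⁻ s′) , ∝-swap _ _ s′
forward (output s) Out output = _ , Out ⊢≈ , s
forward (input {xs = xs} B s) (In {ys = ys} {zs} len) input
  -- The names received for xs, the pattern variables in the order in which the input lists them,
  -- are those that match the pattern ys against zs.
  with _ , d , s′ ← ∝-substitute
         (λ n → ≡-sym (≔-reorder (λ _ → refl) (≐-sym (same-names B)) (≡-sym len) n)) s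
  with _ , d′ , s″ ← ∝-αˡ⁺ (sym d) s′ =
  _ , agents-α refl (In ⊢≈ (match (same-names B) (≡-sym (length-map _ xs)) values)) d′ , s″
  where
  values : map (id [ xs ≔ map (id [ ys ≔ zs ]) xs ]) ys ≡ zs
  values = ≡-trans (map-cong (≔-reorder (λ _ → refl) (≐-sym (same-names B)) (≡-sym len)) ys)
                   (map-≔ id (unique-pattern B) (≡-sym len))
forward (sum g h s₁ s₂) (Sumˡ t) l with _ , t′ , s′ ← forward s₁ t l = _ , Case hereᵇ t′ ⊢⊤ , s′
forward (sum g h s₁ s₂) (Sumʳ t) l with _ , t′ , s′ ← forward s₂ t l =
  _ , Case (thereᵇ hereᵇ) t′ ⊢⊤ , s′
forward (choice g s₁ s₂) (Sumˡ t) l with h , _ , t′ , s′ ← forward⟨⟩ g s₁ t l =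
  _ , Case hereᵇ t′ h , s′
forward (choice g s₁ s₂) (Sumʳ t) l
  with _ , t′ , s′ ← forward s₂ t l with _ , _ , i , h , t″ ← case-inv t′ =
  _ , Case (thereᵇ i) t″ h , s′
forward (match g s) (Match t) l with _ , t′ , s′ ← forward s t l = _ , Case hereᵇ t′ ⊢≈ , s′
forward (s₁ ∣ s₂) (Parˡ t as#) l with _ , t′ , s′ ← forward s₁ t l =
  _ , Parˡ t′ (bn-#⁺ l s₂ as#) , s′ ∣ s₂
forward (s₁ ∣ s₂) (Parʳ t as#) l with _ , t′ , s′ ← forward s₂ t l =
  _ , Parʳ t′ (bn-#⁺ l s₁ as#) , s₁ ∣ s′
forward (ν s) (Res t x#β) l with _ , t′ , s′ ← forward s t l =
  _ , Scope t′ (x#β ∘ ≙-names⁻ l) , ν s′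
forward (rep g s) (Rep t) l with _ , t′ , s′ ← forward (s ∣ rep g s) t l = _ , Rep t′ , s′
forward (s₁ ∣ s₂) (Comˡ {ys′ = as} t u as#) τ
  with _ , t′ , s₁′ ← forward s₁ t output with _ , u′ , s₂′ ← forward s₂ u input =
  _ , Comˡ t′ u′ ⊢≈ (All.map (_∘ ∝-names⁻ s₂) as#) , ∝-ν* as (s₁′ ∣ s₂′)
forward (s₁ ∣ s₂) (Comʳ {ys′ = as} t u as#) τ
  with _ , t′ , s₁′ ← forward s₁ t input with _ , u′ , s₂′ ← forward s₂ u output =
  _ , Comʳ t′ u′ ⊢≈ (All.map (_∘ ∝-names⁻ s₁) as#) , ∝-ν* as (s₁′ ∣ s₂′)
forward (ν s) (Open t x≢z x∈ x∉) output with _ , t′ , s′ ← forward s t output =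
  _ , Open {as = []} t′ x∉ (∉-single x≢z) x∈ , s′

forward⟨⟩ g (true s) t l = ⊢⊤ , forward s t l
forward⟨⟩ g (equal s) t l
  with _ , t′ , s′ ← forward (match g s) t l with _ , _ , hereᵇ , h , t″ ← case-inv t′ =
  h , _ , t″ , s′
forward⟨⟩ g (false D _ _) t l = ⊥-elim (Dead-transition D t)

-- A branch whose condition holds is represented by an agent whose transitions are
-- transitions of the agent that represents the case.
branch : p ∝[ m ] case bs₁ → φ ∶ Q ∈ᵇ bs₁ → 𝟏 ⊢ φ →
         ∃[ q ] q ∝[ m ] Q × (∀ {β r} → q —π[ β ]→ r → p —π[ β ]→ r)
branch (match g s) hereᵇ ⊢≈ = _ , s , Match
branch (sum g h s t) hereᵇ ⊢⊤ = _ , s , Sumˡ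
branch (sum g h s t) (thereᵇ hereᵇ) ⊢⊤ = _ , t , Sumʳ
branch (choice g (true s) t) hereᵇ ⊢⊤ = _ , s , Sumˡ
branch (choice g (equal s) t) hereᵇ ⊢≈ = _ , s , Sumˡ ∘ Match
branch (choice g s t) (thereᵇ i) h with _ , s′ , lift ← branch t i h = _ , s′ , Sumʳ ∘ lift

backward : p ∝[ m ] P → P —ψ[ α ]→ P′ →
           ∃[ β ] ∃[ p′ ] β ≙ α × p —π[ β ]→ p′ × p′ ∝[ m ] P′
backward s (agents-α d t e)
  with _ , d′ , s₁ ← ∝-αʳ⁺ d s with _ , _ , l , t′ , s₂ ← backward s₁ t
  with _ , e′ , s₃ ← ∝-αʳ⁺ e s₂ =
  _ , _ , l , agents-α d′ t′ e′ , s₃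
backward s (bound-α t a∈ b#M b#N b#P) with _ , _ , output , t′ , s′ ← backward s t =
  _ , _ , output , bound-α t′ a∈ (b#M ∘ here) b#N (b#P ∘ ∝-names⁺ s′) , ∝-swap _ _ s′
backward (input {ys = ys} B s) (In {K = name _} ⊢≈ (match e len refl))
  with _ , d , s′ ← ∝-substitute (≔-reorder (λ _ → refl) (same-names B) len) s =
  _ , _ , input , agents-α refl (In (length-map _ ys)) d , s′
backward (output s) (Out {K = name _} ⊢≈) = _ , _ , output , Out , s
backward (s₁ ∣ s₂) (Comˡ {as = as} t u h as#)
  with _ , _ , output , t′ , s₁′ ← backward s₁ t with _ , _ , input , u′ , s₂′ ← backward s₂ u
  with ⊢≈ ← h =
  _ , _ , τ , Comˡ t′ u′ (All.map (_∘ ∝-names⁺ s₂) as#) , ∝-ν* as (s₁′ ∣ s₂′)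
backward (s₁ ∣ s₂) (Comʳ {as = as} t u h as#)
  with _ , _ , input , t′ , s₁′ ← backward s₁ t with _ , _ , output , u′ , s₂′ ← backward s₂ u
  with ⊢≈ ← h =
  _ , _ , τ , Comʳ t′ u′ (All.map (_∘ ∝-names⁺ s₁) as#) , ∝-ν* as (s₁′ ∣ s₂′)
backward (s₁ ∣ s₂) (Parˡ t as#) with _ , _ , l , t′ , s′ ← backward s₁ t =
  _ , _ , l , Parˡ t′ (bn-#⁻ l s₂ as#) , s′ ∣ s₂
backward (s₁ ∣ s₂) (Parʳ t as#) with _ , _ , l , t′ , s′ ← backward s₂ t =
  _ , _ , l , Parʳ t′ (bn-#⁻ l s₁ as#) , s₁ ∣ s′
backward s (Case i t h) with _ , s₁ , lift ← branch s i h with _ , _ , l , t′ , s′ ← backward s₁ t =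
  _ , _ , l , lift t′ , s′
backward (rep g s) (Rep t) with _ , _ , l , t′ , s′ ← backward (s ∣ rep g s) t =
  _ , _ , l , Rep t′ , s′
backward (ν s) (Scope t b#α) with _ , _ , l , t′ , s′ ← backward s t =
  _ , _ , l , Res t′ (b#α ∘ ≙-names⁺ l) , ν s′
backward (ν s) (Open {as = as} {as′} {b = b} t b#as b#M b∈N)
  with _ , _ , output , t′ , s′ ← backward s t =
  -- The psi-calculus inserts the opened name anywhere, the pi-calculus in front.
  _ , _ , output
    , actions-≈ (Open t′ (b#M ∘ here) b∈N b#as) (output (↭-sym (shift b as as′))) , s′

subject-∉-bound : ∀ {as z ys} → p —π[ output as z ys ]→ p′ → z ∉ as
subject-∉-bound (agents-α d t e) = subject-∉-bound t
subject-∉-bound (actions-≈ t (output r)) z∈ = subject-∉-bound t (∈-resp-↭ (↭-sym r) z∈)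
subject-∉-bound (bound-α {ys′ = as} {z} {a = a} {b} t a∈ b≢z b#ys b#p) z∈ =
  subject-∉-bound t (subst (_∈ as)
    (swapName-other a b (λ { refl → subject-∉-bound t a∈ }) (b≢z ∘ ≡-sym)) (∈-swap⁻ a b as z∈))
subject-∉-bound Out ()
subject-∉-bound (Sumˡ t) = subject-∉-bound t
subject-∉-bound (Sumʳ t) = subject-∉-bound t
subject-∉-bound (Match t) = subject-∉-bound t
subject-∉-bound (Parˡ t _) = subject-∉-bound t
subject-∉-bound (Parʳ t _) = subject-∉-bound t
subject-∉-bound (Res t _) = subject-∉-bound t
subject-∉-bound (Rep t) = subject-∉-bound t
subject-∉-bound (Open t x≢z _ _) (here refl) = x≢z refl
subject-∉-bound (Open t x≢z _ _) (there z∈)  = subject-∉-bound t z∈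

-- The encoding is a representation

encodeProcess : PolyadicPi.Process → PPI.Process
encodeProcess (p ,π w) = encode p ,ψ ∝-wellFormed (encode-∝ {m = exact} w)

encode-α : ∀ {p q} → PolyadicPi.WellFormed p → p =π q → encode p =ψ encode q
encode-α w d with Q , e , s ← ∝-αˡ⁺ d (encode-∝ {m = exact} w) with refl ← exact-encode s = e

encode-swap : ∀ a b {p} → PolyadicPi.WellFormed p → encode (swap a b p) ≡ swap a b (encode p)
encode-swap a b w = ≡-sym (exact-encode (∝-swap a b (encode-∝ w)))

infix 4 _≊_

-- Actions correspond if they agree up to the order of the bound names, which is immaterial in
-- the pi-calculus.
data _≊_ : Actionπ → Actionψ → Set where
  output : ∀ {as bs z ys} → as ↭ bs → output as z ys ≊ output (name z) bs (tuple ys)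
  input  : ∀ {x zs} → input x zs ≊ input (name x) (tuple zs)
  τ      : τ ≊ τ

≙⇒≊ : β ≙ α → β ≊ α
≙⇒≊ output = output ↭-refl
≙⇒≊ input  = input
≙⇒≊ τ      = τ

≊-resp-≈ₐ : ∀ {β′} → β ≈ₐ β′ → β ≊ α → β′ ≊ α
≊-resp-≈ₐ (output r) (output r′) = output (↭-trans (↭-sym r) r′)
≊-resp-≈ₐ input      input       = input
≊-resp-≈ₐ τ          τ           = τ

≊-swap : ∀ a b → β ≊ α → swap a b β ≊ swap a b α
≊-swap a b (output r) = output (↭.map⁺ (swapName a b) r)
≊-swap a b input      = input
≊-swap a b τ          = τ

encodeAction : (β : PolyadicPi.Action) → Σ PPI.Action λ α → PolyadicPi.label β ≙ PPI.label α
encodeAction (output as z ys ,π PolyadicPi.output u s _) =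
  (output (name z) as (tuple ys) ,ψ PPI.output u s) , output
encodeAction (input x zs ,π _) = (input (name x) (tuple zs) ,ψ PPI.input) , input
encodeAction (τ ,π _)          = (τ ,ψ PPI.τ) , τ

≙-wellFormed : PPI.WellFormedAction α → β ≙ α → p —π[ β ]→ p′ → PolyadicPi.WellFormedAction β
≙-wellFormed (PPI.output u s) output t = PolyadicPi.output u s (subject-∉-bound t)
≙-wellFormed w input t = PolyadicPi.input
≙-wellFormed w τ     t = PolyadicPi.τ

-- The clause of encode for each process constructor, as a context.
context : ∀ {k} → PolyadicPi.Constructor k → PPI.Context k
context 𝟎              = case []
context (input x ys _) = input (name x) ys ⟨ ys ⟩ hole
context (output x ys)  = output (name x) (tuple ys) hole
context (match a b)    = case (a ≈ b ∶ hole □ [])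
context (ν x)          = ν x hole
context rep            = ! hole
context par            = hole ∣ hole
context sum            = case (⊤ᶜ ∶ hole □ ⊤ᶜ ∶ hole □ [])

context-swap : ∀ {k} a b (f : PolyadicPi.Constructor k) →
               context (PolyadicPi.swapConstructor a b f) ≡ PPI.swapContext a b (context f)
context-swap a b 𝟎              = refl
context-swap a b (input x ys u) = refl
context-swap a b (output x ys)  = refl
context-swap a b (match c d)    = refl
context-swap a b (ν x)          = refl
context-swap a b rep            = refl
context-swap a b par            = refl
context-swap a b sum            = refl

encode-construct : ∀ {k} (f : PolyadicPi.Constructor k) (ps : Vec PolyadicPi.Process k) →
  encode (PolyadicPi.agent (PolyadicPi.construct f ps)) =ψ
  PPI.fill (context f) (Vec.map (PPI.agent ∘ encodeProcess) ps)
encode-construct 𝟎              []                = refl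
encode-construct (input x ys u) (_ ∷ [])          = refl
encode-construct (output x ys)  (_ ∷ [])          = refl
encode-construct (match a b)    (_ ∷ [])          = refl
encode-construct (ν x)          (_ ∷ [])          = refl
encode-construct rep            (_ ∷ [])          = refl
encode-construct par            (_ ∷ _ ∷ [])      = refl
encode-construct sum            (_ ∷ _ ∷ [])      = refl

representation : Representation polyadicPi
representation = record
  { ⟦_⟧                 = encodeProcess
  ; ⟦⟧-cong             = λ { {_ ,π w} d → encode-α w d }
  ; ⟦⟧-equivariant      = λ { a b (p ,π w) →
                              subst (encode (swap a b p) =ψ_) (encode-swap a b w) refl }
  ; _≊_                 = λ β α → PolyadicPi.label β ≊ PPI.label α
  ; ≊-resp              = ≊-resp-≈ₐ
  ; ≊-equivariant       = λ a b → ≊-swap a b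
  ; context             = context
  ; context-equivariant = context-swap
  ; compositional       = encode-construct
  ; preserves           = λ {P} {β} {P′} → preserves P β P′
  ; reflects            = λ {P} {α} {Q} → reflects P α Q
  }
  where
  open PPI using (_≋_)

  preserves : ∀ P β P′ → PolyadicPi.agent P —π[ PolyadicPi.label β ]→ PolyadicPi.agent P′ →
    Σ PPI.Action λ α → Σ PPI.Process λ Q →
      encode (PolyadicPi.agent P) —ψ[ PPI.label α ]→ PPI.agent Q ×
      encode (PolyadicPi.agent P′) ≋ PPI.agent Q × PolyadicPi.label β ≊ PPI.label α
  preserves (p ,π w) β P′ t with α , l ← encodeAction β
    with _ , t′ , s ← forward (encode-∝ {m = exact} w) t l with refl ← exact-encode s =
    α , encodeProcess P′ , t′ , PPI._≋_.refl , ≙⇒≊ l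

  reflects : ∀ P (α : PPI.Action) (Q : PPI.Process) →
    encode (PolyadicPi.agent P) —ψ[ PPI.label α ]→ PPI.agent Q →
    Σ PolyadicPi.Action λ β → Σ PolyadicPi.Process λ P′ →
      PolyadicPi.agent P —π[ PolyadicPi.label β ]→ PolyadicPi.agent P′ ×
      encode (PolyadicPi.agent P′) ≋ PPI.agent Q × PolyadicPi.label β ≊ PPI.label α
  reflects (p ,π w) (α ,ψ wα) (Q ,ψ _) t
    with β , p′ , l , t′ , s ← backward (encode-∝ {m = exact} w) t with refl ← exact-encode s =
    (β ,π ≙-wellFormed wα l t′) , (p′ ,π exact-wellFormed s) , t′ , PPI._≋_.refl , ≙⇒≊ l

-- The representation is complete

-- Two processes are related if alpha-equivalent pi-calculus agents represent them.
_≅_ : PPI.Process → PPI.Process → Set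
P ≅ Q = ∃[ p ] ∃[ q ] p =π q × p ∝[ loose ] PPI.agent P × q ∝[ loose ] PPI.agent Q

≅-isBisimulation : PPI.IsBisimulation _≅_
≅-isBisimulation = record
  { symmetric = λ { (p , q , d , s , t) → q , p , sym d , t , s }
  ; simulates = λ {P} {Q} {P′} {α} → simulates {P} {Q} {P′} {α}
  }
  where
  simulates : ∀ {P Q P′ : PPI.Process} {α : PPI.Action} → P ≅ Q →
    PPI.bn (PPI.label α) #* PPI.agent Q → PPI.agent P —ψ[ PPI.label α ]→ PPI.agent P′ →
    ∃[ Q′ ] PPI.agent Q —ψ[ PPI.label α ]→ PPI.agent Q′ × P′ ≅ Q′
  simulates (_ , _ , d , s , s′) _ t
    with _ , p′ , l , t′ , s₁ ← backward s t
    with Q′ , t″ , s₂ ← forward s′ (agents-α (sym d) t′ refl) l =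
    (Q′ ,ψ ∝-wellFormed s₂) , t″ , p′ , p′ , refl , s₁ , s₂

≅-substitute : ∀ {P Q} σs → P ≅ Q → (P PPI.⟪ σs ⟫*) ≅ (Q PPI.⟪ σs ⟫*)
≅-substitute [] r = r
≅-substitute (σ ∷ σs) (_ , _ , d , s , t)
  with p , e , s′ ← ∝-substitute {σ = apply σ} (λ _ → refl) s
  with q , f , t′ ← ∝-substitute {σ = apply σ} (λ _ → refl) t =
  ≅-substitute σs (p , q , trans (sym e) (trans (substitute-α (apply σ) d) f) , s′ , t′)

theorem4p10 : CompleteRepresentation polyadicPi
theorem4p10 = record { representation = representation ; complete = complete }
  where
  complete : ∀ P → Σ PolyadicPi.Process λ Q → P PPI.∼ encodeProcess Q
  complete (P ,ψ w) with p , v , s ← decode w =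
    (p ,π v) , λ σs → _≅_ , ≅-isBisimulation ,
      ≅-substitute σs (p , p , refl , s , encode-∝ v)
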